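{- For every graph $G=(V,E)$ with $n=|V|\ge 2$ vertices and minimum degree $\delta$, and every pair of distinct vertices $s\neq v$ in $V$, $$\mathsf{C}(s,v)\;\le\; 4\cdot\frac{|E|}{\delta}\cdot \mathbf{E}[\mathsf{RBA}(s,v)].$$ Consequently there is an absolute constant $C>0$ such that for every such graph $G$, $$\mathsf{COV}(G)\;\le\; C\cdot\frac{|E|}{\delta}\cdot\log n\cdot \mathbf{E}[\mathsf{RBA}(G)],$$ or equivalently $\mathcal{R}(G)=O\!\left(\frac{|E|}{\delta}\cdot\log n\right)$.
   Context: Graphs are finite, undirected, simple and connected. A random walk on $G$ moves at each step from its current vertex to a neighbor chosen uniformly at random. The hitting time $\mathsf{H}(u,v)$ is the expected number of steps for the walk started at $u$ to reach $v$; the commute time is $\mathsf{C}(u,v)=\mathsf{H}(u,v)+\mathsf{H}(v,u)$. The cover time $\mathsf{COV}(s)$ is the expected number of steps for the walk started at $s$ to visit all vertices, and $\mathsf{COV}(G)=\max_{s\in V}\mathsf{COV}(s)$. Randomized broadcast algorithm $\mathsf{RBA}$ (push algorithm): at time $0$ only a vertex $s$ knows a rumor; at each time step $t=1,2,\dots$ every vertex that knows the rumor chooses, independently, a neighbor uniformly at random and informs it. $I_t$ is the set of informed vertices at time $t$ ($I_0=\{s\}$). $\mathsf{RBA}(s,v)$ is the random time $\min\{t\in\mathbb{N}: v\in I_t\}$ when $I_0=\{s\}$. The expected broadcast time is $\mathbf{E}[\mathsf{RBA}(G)]:=\max_{s\in V}\mathbf{E}[\min\{t: I_t=V\}\text{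 with } I_0=\{s\}]$. Finally $\mathcal{R}(G):=\mathsf{COV}(G)/\mathbf{E}[\mathsf{RBA}(G)]$. -}

module Defs where

open import Algebra.Properties.CommutativeMonoid.Sum as Sum using ()
open import Data.Bool.Properties as Bool using ()
open import Data.Fin.Base as Fin using (Fin; zero; suc)
open import Data.Fin.Properties as Fin using ()
open import Data.Fin.Subset using (Subset; _∈_; _∪_; ⁅_⁆; ⊤; ⋃)
open import Data.Fin.Subset.Properties using (_∈?_)
open import Data.Integer.Base as ℤ using (+_)
open import Data.List.Base using (List; []; _∷_; allFin; cartesianProduct; drop; filter; inits; length; lookup; map; takeWhile)
open import Data.List.Extrema.Nat using (min; v<min⁺)
open import Data.List.Membership.Propositional using () renaming (_∈_ to _∈ₗ_)
open import Data.List.Membership.Propositional.Properties using (∈-allFin; ∈-filter⁺)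
open import Data.List.Relation.Unary.All.Properties as All using ()
open import Data.Nat.Base as ℕ using (ℕ; zero; suc; 2+; NonZero; NonTrivial; _^_)
open import Data.Nat.Properties as ℕ using ()
open import Data.Product.Base using (∃-syntax; _×_; _,_)
open import Data.Rational.Base using (ℚ; 0ℚ; _/_; _+_; _*_; _≤_; _<_; ↥_; ↧ₙ_)
open import Data.Rational.Properties using (+-0-commutativeMonoid)
open import Data.Sum.Base using (_⊎_)
open import Data.Vec.Properties as Vec using ()
open import Relation.Binary.Construct.Closure.ReflexiveTransitive using (Star; ε; _◅_)
open import Relation.Binary.Definitions as Binary using (Symmetric)
open import Relation.Binary.PropositionalEquality using (_≡_; _≢_; refl)
open import Relation.Nullary using (¬_; contradiction)
open import Relation.Nullary.Decidable using (_×-dec_)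
open import Relation.Unary using (Decidable)
open import Relation.Unary.Properties using (∁?)

open Sum +-0-commutativeMonoid using (sum)

------------------------------------------------------------------------
-- Extended non-negative reals, given by their cuts of rationals
-- (lower q : "q < x", upper q : "x < q").  The arithmetic operations
-- below are the usual ones for numbers in [0,∞].

record ℝ⁺ : Set₁ where
  field
    lower : ℚ → Set
    upper : ℚ → Set

open ℝ⁺ public

infix  4 _≼_
infixl 6 _⊕_
infixl 7 _⊗_ _⊘_

_≼_ : ℝ⁺ → ℝ⁺ → Set
x ≼ y = ∀ q → lower x q → lower y q

⟦_⟧ : ℚ → ℝ⁺
lower ⟦ r ⟧ q = q < r
upper ⟦ r ⟧ q = r < q

_⊕_ : ℝ⁺ → ℝ⁺ → ℝ⁺
lower (x ⊕ y) q = ∃[ a ] ∃[ b ] lower x a × lower y b × q < a + b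
upper (x ⊕ y) q = ∃[ a ] ∃[ b ] upper x a × upper y b × a + b < q

_⊗_ : ℝ⁺ → ℝ⁺ → ℝ⁺
lower (x ⊗ y) q = q < 0ℚ ⊎ ∃[ a ] ∃[ b ] (0ℚ ≤ a × lower x a) × (0ℚ ≤ b × lower y b) × q < a * b
upper (x ⊗ y) q = ∃[ a ] ∃[ b ] upper x a × upper y b × a * b < q

_⊘_ : ℝ⁺ → ℝ⁺ → ℝ⁺
lower (x ⊘ y) q = q < 0ℚ ⊎ ∃[ a ] ∃[ b ] lower x a × upper y b × q * b < a
upper (x ⊘ y) q = ∃[ a ] ∃[ b ] upper x a × (0ℚ < b × lower y b) × a < q * b

supremum : (ℕ → ℚ) → ℝ⁺
lower (supremum x) q = ∃[ N ] q < x N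
upper (supremum x) q = ∃[ r ] (∀ N → x N ≤ r) × r < q

maximum : ∀ {n} → (Fin n → ℝ⁺) → ℝ⁺
lower (maximum x) q = ∃[ i ] lower (x i) q
upper (maximum x) q = ∀ i → upper (x i) q

-- p / k < log₂ n  iff  2 ^ p < n ^ k, for n ≥ 1.
log₂ : ℕ → ℝ⁺
lower (log₂ n) q = q < 0ℚ ⊎ 2 ^ ℤ.∣ ↥ q ∣ ℕ.< n ^ ↧ₙ q
upper (log₂ n) q = 0ℚ < q × n ^ ↧ₙ q ℕ.< 2 ^ ℤ.∣ ↥ q ∣

------------------------------------------------------------------------
-- Finite random experiments: a tree of successive uniform choices, each
-- made independently of the previous ones.

data Random (A : Set) : Set where
  pure : A → Random A
  pick : ∀ k .{{_ : NonZero k}} → (Fin k → Random A) → Random A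

infixl 1 _>>=_

_>>=_ : ∀ {A B} → Random A → (A → Random B) → Random B
pure x   >>= f = f x
pick k g >>= f = pick k λ i → g i >>= f

uniform : ∀ {A : Set} (xs : List A) .{{_ : NonZero (length xs)}} → Random A
uniform xs = pick (length xs) λ i → pure (lookup xs i)

independently : ∀ {A B : Set} → (A → Random B) → List A → Random (List B)
independently f []       = pure []
independently f (x ∷ xs) = f x >>= λ y → independently f xs >>= λ ys → pure (y ∷ ys)

𝔼 : ∀ {A} → Random A → (A → ℚ) → ℚ
𝔼 (pure x)   f = f x
𝔼 (pick k g) f = (+ 1 / k) * sum (λ i → 𝔼 (g i) f)

-- The first N states X₀, …, X_{N-1} of the Markov chain started at X₀ = x.
trajectory : ∀ {S} → (S → Random S) → S → ℕ → Random (List S)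
trajectory step x zero    = pure []
trajectory step x (suc N) = step x >>= λ y → trajectory step y N >>= λ ω → pure (x ∷ ω)

-- On X₀, …, X_{N-1} this is min(T, N), where T = min { t : P Xₜ }.
firstTime : ∀ {S : Set} {P : S → Set} → Decidable P → List S → ℕ
firstTime P? ω = length (takeWhile (∁? P?) ω)

-- E[T] = sup_N E[min(T, N)], where T is given by the values that min(T, N)
-- takes on the trajectories X₀, …, X_{N-1}.
expectedTime : ∀ {S} → (S → Random S) → S → (List S → ℕ) → ℝ⁺
expectedTime step x T = supremum λ N → 𝔼 (trajectory step x N) λ ω → + T ω / 1

------------------------------------------------------------------------

record Graph (n : ℕ) : Set₁ where
  field
    Adj       : Fin n → Fin n → Set
    adj?      : Binary.Decidable Adj
    symmetric : Symmetric Adj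
    loopless  : ∀ u → ¬ Adj u u
    connected : ∀ u v → Star Adj u v

  neighbours : Fin n → List (Fin n)
  neighbours u = filter (adj? u) (allFin n)

  degree : Fin n → ℕ
  degree u = length (neighbours u)

  -- The default value n exceeds every degree.
  δ : ℕ
  δ = min n (map degree (allFin n))

  edges : List (Fin n × Fin n)
  edges = filter (λ (u , v) → u Fin.<? v ×-dec adj? u v) (cartesianProduct (allFin n) (allFin n))

  ∣E∣ : ℕ
  ∣E∣ = length edges

private
  another : ∀ {n} .{{_ : NonTrivial n}} (u : Fin n) → ∃[ w ] u ≢ w
  another {2+ _} zero    = suc zero , λ ()
  another {2+ _} (suc _) = zero , λ ()

  firstEdge : ∀ {n} (G : Graph n) {u w} → u ≢ w → Star (Graph.Adj G) u w → ∃[ x ] Graph.Adj G u x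
  firstEdge G u≢w ε       = contradiction refl u≢w
  firstEdge G u≢w (e ◅ _) = _ , e

  length>0 : ∀ {A : Set} {x : A} {xs} → x ∈ₗ xs → 0 ℕ.< length xs
  length>0 {xs = _ ∷ _} _ = ℕ.z<s

module _ {n} .{{_ : NonTrivial n}} (G : Graph n) where
  open Graph G

  degree>0 : ∀ u → 0 ℕ.< degree u
  degree>0 u with another u
  ... | w , u≢w with firstEdge G u≢w (connected u w)
  ...   | x , e = length>0 (∈-filter⁺ (adj? u) (∈-allFin x) e)

  degree-nonZero : ∀ u → NonZero (degree u)
  degree-nonZero u = ℕ.>-nonZero (degree>0 u)

  δ-nonZero : NonZero δ
  δ-nonZero = ℕ.>-nonZero (v<min⁺ (ℕ.<-trans ℕ.z<s (ℕ.nonTrivial⇒n>1 n)) (All.map⁺ (All.tabulate⁺ degree>0)))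

  ∣E∣/δ : ℚ
  ∣E∣/δ = (+ ∣E∣ / δ) {{δ-nonZero}}

  randomNeighbour : Fin n → Random (Fin n)
  randomNeighbour u = uniform (neighbours u) {{degree-nonZero u}}

  range : List (Fin n) → Subset n
  range us = ⋃ (map ⁅_⁆ us)

  -- {X₀}, {X₀, X₁}, …
  visited : List (Fin n) → List (Subset n)
  visited ω = drop 1 (map range (inits ω))

  everyone? : Decidable (_≡ ⊤ {n})
  everyone? I = Vec.≡-dec Bool._≟_ I ⊤

  H : Fin n → Fin n → ℝ⁺
  H u v = expectedTime randomNeighbour u (firstTime (Fin._≟ v))

  C : Fin n → Fin n → ℝ⁺
  C u v = H u v ⊕ H v u

  COVfrom : Fin n → ℝ⁺
  COVfrom s = expectedTime randomNeighbour s (λ ω → firstTime everyone? (visited ω))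

  COV : ℝ⁺
  COV = maximum COVfrom

  push : Subset n → Random (Subset n)
  push I = independently randomNeighbour (filter (_∈? I) (allFin n)) >>= λ ws → pure (I ∪ range ws)

  𝔼RBAto : Fin n → Fin n → ℝ⁺
  𝔼RBAto s v = expectedTime push ⁅ s ⁆ (firstTime (v ∈?_))

  𝔼RBAfrom : Fin n → ℝ⁺
  𝔼RBAfrom s = expectedTime push ⁅ s ⁆ (firstTime everyone?)

  𝔼RBA : ℝ⁺
  𝔼RBA = maximum 𝔼RBAfrom

  𝓡 : ℝ⁺
  𝓡 = COV ⊘ 𝔼RBA

{-# OPTIONS --safe #-}

-- Write R(I) for the effective resistance between an informed set I and v,
-- that is φ(v), where φ is the potential that vanishes on I and has Laplacian
-- 1 at v and 0 elsewhere.  The commute time is 2|E| R({s}).  If the calls of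
-- one round reach the vertices ws, then R drops by at most Σ φ(w), by the
-- maximum principle; as an informed x calls each of its neighbours with
-- probability at most 1/δ, the expected drop is at most 1/δ times the flow
-- into I, which is 1.  Hence R({s}) ≤ E[RBA(s,v)] / δ.  To remain with the
-- finite truncations min(RBA, N), the contribution of the runs longer than N
-- is estimated by Markov's inequality, at the price of a factor 3/2.
--
-- For the cover time let h be the largest hitting time.  The sum of h + H(x,v)
-- over the m unvisited v is between hm and 2hm and decreases by m per step in
-- expectation, so the logarithm of this sum decreases at rate 1/(2h); a family
-- of affine majorants replaces the logarithm.

module Submission where

open import Algebra.Bundles using (CommutativeRing)
open import Algebra.Properties.CommutativeMonoid.Sum as CommutativeMonoidSum using ()
open import Algebra.Properties.Semiring.Sum as SemiringSum using ()
open import Data.Bool.Base using (Bool; true; false; if_then_else_)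
open import Data.Fin.Base as Fin using (Fin; zero; suc)
open import Data.Fin.Properties as Fin using ()
open import Data.Fin.Subset using (Subset; _∈_; _∪_; ⁅_⁆; ⊤; ⊥)
open import Data.Fin.Subset.Properties using (_∈?_; x∈p∪q⁻; x∈p∪q⁺; x∈⁅y⁆⇒x≡y; x∈⁅x⁆; ∉⊥; ∈⊤; ⊆⊤; ⊆-antisym; ∪-assoc; ∪-identityˡ; ∪-identityʳ)
open import Data.Integer.Base as ℤ using (+_; +≤+)
open import Data.Integer.Properties as ℤ using ()
open import Data.List.Base using (List; []; _∷_; _++_; allFin; cartesianProduct; drop; filter; inits; length; lookup; map; tabulate)
open import Data.List.Extrema.Nat using (min≤xs)
import Data.List.Membership.DecPropositional as ListMembership
open import Data.List.Membership.Propositional using () renaming (_∈_ to _∈ₗ_)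
open import Data.List.Membership.Propositional.Properties using (∈-allFin; ∈-map⁺)
open import Data.List.Properties using (map-∘; map-cong)
open import Data.List.Relation.Unary.All as All using ()
open import Data.List.Relation.Unary.Any using (here; there)
open import Data.Nat.Base as ℕ using (ℕ; zero; suc; NonZero; NonTrivial; z≤n; s≤s; _^_)
open import Data.Nat.Coprimality as Coprime using ()
open import Data.Nat.Properties as ℕ using ()
open import Data.Product.Base using (_×_; _,_; ∃-syntax; proj₁; proj₂)
open import Data.Rational.Base using (ℚ; mkℚ; 0ℚ; 1ℚ; ½; _/_; _+_; _*_; _-_; -_; 1/_; _≤_; _<_; *≤*; *<*; toℚᵘ; nonNegative; positive; ≢-nonZero)
open import Data.Rational.Properties
open import Data.Rational.Solver using (module +-*-Solver)
open import Data.Rational.Unnormalised.Base as ℚᵘ using (mkℚᵘ)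
open import Data.Rational.Unnormalised.Properties as ℚᵘ using ()
open import Data.Sum.Base using (_⊎_; inj₁; inj₂; [_,_]′)
open import Function.Base using (_∘_; id; case_of_)
open import Relation.Binary.Construct.Closure.ReflexiveTransitive using (Star; ε; _◅_)
open import Relation.Binary.Definitions using (tri<; tri≈; tri>)
open import Relation.Binary.PropositionalEquality using (_≡_; _≢_; refl; sym; trans; cong; cong₂; subst; subst₂; module ≡-Reasoning)
open import Relation.Nullary using (¬_; Dec; yes; no; does; contradiction; ¬?)
open import Relation.Nullary.Decidable using (_×-dec_; _⊎-dec_; dec-true; dec-false)
open import Relation.Unary using (Decidable)
open import Defs

open CommutativeMonoidSum +-0-commutativeMonoid using (sum; ∑-distrib-+; ∑-comm; sum-cong-≗; sum-replicate-zero)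
open SemiringSum (CommutativeRing.semiring +-*-commutativeRing) using (*-distribˡ-sum)
open +-*-Solver using (solve; con; _:=_; _:+_; _:*_; _:-_; :-_)

-- Natural numbers and order in the rationals

ι : ℕ → ℚ
ι k = + k / 1

-- For variable `k` the fraction `+ k / 1` is stuck on a gcd; rewriting with this normal form lets
-- sums, products and comparisons compute.
ι≡mkℚ : ∀ k → ι k ≡ mkℚ (+ k) 0 (Coprime.sym (Coprime.1-coprimeTo k))
ι≡mkℚ k = normalize-coprime (Coprime.sym (Coprime.1-coprimeTo k))

toℚᵘ-/ : ∀ m k .{{_ : NonZero k}} → toℚᵘ (+ m / k) ℚᵘ.≃ (+ m ℚᵘ./ k)
toℚᵘ-/ m (suc k) = toℚᵘ-fromℚᵘ (mkℚᵘ (+ m) k)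

ι-+ : ∀ m k → ι (m ℕ.+ k) ≡ ι m + ι k
ι-+ m k rewrite ι≡mkℚ m | ι≡mkℚ k = cong (_/ 1) (cong₂ ℤ._+_ (sym (ℤ.*-identityʳ (+ m))) (sym (ℤ.*-identityʳ (+ k))))

ι-* : ∀ m k → ι (m ℕ.* k) ≡ ι m * ι k
ι-* m k rewrite ι≡mkℚ m | ι≡mkℚ k = cong (_/ 1) (ℤ.pos-* m k)

ι-suc : ∀ k → ι (suc k) ≡ 1ℚ + ι k
ι-suc k = ι-+ 1 k

ι-mono : ∀ {m k} → m ℕ.≤ k → ι m ≤ ι k
ι-mono {m} {k} m≤k rewrite ι≡mkℚ m | ι≡mkℚ k = *≤* (subst₂ ℤ._≤_ (sym (ℤ.*-identityʳ (+ m))) (sym (ℤ.*-identityʳ (+ k))) (+≤+ m≤k))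

0≤ι : ∀ k → 0ℚ ≤ ι k
0≤ι k = ι-mono {0} {k} ℕ.z≤n

m/k≡m*1/k : ∀ m k .{{_ : NonZero k}} → + m / k ≡ ι m * (+ 1 / k)
m/k≡m*1/k m k@(suc _) = toℚᵘ-injective (begin
  toℚᵘ (+ m / k)                       ≈⟨ toℚᵘ-/ m k ⟩
  + m ℚᵘ./ k                           ≈⟨ ℚᵘ.*≡* (trans (cong (λ j → + m ℤ.* (+ j)) (ℕ.+-identityʳ k)) (cong (ℤ._* (+ k)) (sym (ℤ.*-identityʳ (+ m))))) ⟩
  (+ m ℚᵘ./ 1) ℚᵘ.* (+ 1 ℚᵘ./ k)       ≈⟨ ℚᵘ.*-cong (toℚᵘ-/ m 1) (toℚᵘ-/ 1 k) ⟨
  toℚᵘ (ι m) ℚᵘ.* toℚᵘ (+ 1 / k)       ≈⟨ toℚᵘ-homo-* (ι m) (+ 1 / k) ⟨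
  toℚᵘ (ι m * (+ 1 / k))               ∎)
  where open ℚᵘ.≃-Reasoning

1/k*k≡1 : ∀ k .{{_ : NonZero k}} → (+ 1 / k) * ι k ≡ 1ℚ
1/k*k≡1 k@(suc _) = toℚᵘ-injective (begin
  toℚᵘ ((+ 1 / k) * ι k)               ≈⟨ toℚᵘ-homo-* (+ 1 / k) (ι k) ⟩
  toℚᵘ (+ 1 / k) ℚᵘ.* toℚᵘ (ι k)       ≈⟨ ℚᵘ.*-cong (toℚᵘ-/ 1 k) (toℚᵘ-/ k 1) ⟩
  (+ 1 ℚᵘ./ k) ℚᵘ.* (+ k ℚᵘ./ 1)       ≈⟨ ℚᵘ.*≡* (trans (ℤ.*-identityʳ _) (cong (λ j → + 1 ℤ.* (+ j)) (sym (ℕ.*-identityʳ k)))) ⟩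
  toℚᵘ 1ℚ                              ∎)
  where open ℚᵘ.≃-Reasoning

0<1/k : ∀ k .{{_ : NonZero k}} → 0ℚ < + 1 / k
0<1/k k = positive⁻¹ (+ 1 / k) {{normalize-pos 1 k}}

-- Inequalities are mostly proved by exhibiting the difference of the
-- two sides as a sum of products of non-negative terms.

≤-by-difference : ∀ {x y} z → 0ℚ ≤ z → y - x ≡ z → x ≤ y
≤-by-difference {x} {y} z 0≤z eq = subst₂ _≤_ (+-identityʳ x) (solve 2 (λ x y → x :+ (y :- x) := y) refl x y)
  (+-monoʳ-≤ x (subst (0ℚ ≤_) (sym eq) 0≤z))

<-by-difference : ∀ {x y} z → 0ℚ < z → y - x ≡ z → x < y
<-by-difference {x} {y} z 0<z eq = subst₂ _<_ (+-identityʳ x) (solve 2 (λ x y → x :+ (y :- x) := y) refl x y)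
  (+-monoʳ-< x (subst (0ℚ <_) (sym eq) 0<z))

x≤y⇒0≤y-x : ∀ {x y} → x ≤ y → 0ℚ ≤ y - x
x≤y⇒0≤y-x {x} {y} x≤y = subst (_≤ y - x) (+-inverseʳ x) (+-monoˡ-≤ (- x) x≤y)

0≤+ : ∀ {x y} → 0ℚ ≤ x → 0ℚ ≤ y → 0ℚ ≤ x + y
0≤+ 0≤x 0≤y = +-mono-≤ 0≤x 0≤y

0≤* : ∀ {x y} → 0ℚ ≤ x → 0ℚ ≤ y → 0ℚ ≤ x * y
0≤* {x} {y} 0≤x 0≤y = nonNegative⁻¹ (x * y) {{nonNeg*nonNeg⇒nonNeg x {{nonNegative 0≤x}} y {{nonNegative 0≤y}}}}

0<* : ∀ {x y} → 0ℚ < x → 0ℚ < y → 0ℚ < x * y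
0<* {x} {y} 0<x 0<y = positive⁻¹ (x * y) {{pos*pos⇒pos x {{positive 0<x}} y {{positive 0<y}}}}

*-monoˡ : ∀ {x y z} → 0ℚ ≤ x → y ≤ z → x * y ≤ x * z
*-monoˡ {x} 0≤x y≤z = *-monoˡ-≤-nonNeg x {{nonNegative 0≤x}} y≤z

*-monoʳ : ∀ {x y z} → 0ℚ ≤ x → y ≤ z → y * x ≤ z * x
*-monoʳ {x} 0≤x y≤z = *-monoʳ-≤-nonNeg x {{nonNegative 0≤x}} y≤z

-- Finite sums and maxima

sum-mono : ∀ {k} {f g : Fin k → ℚ} → (∀ i → f i ≤ g i) → sum f ≤ sum g
sum-mono {zero}  f≤g = ≤-refl
sum-mono {suc k} f≤g = +-mono-≤ (f≤g zero) (sum-mono (f≤g ∘ suc))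

sum-const : ∀ k x → sum {k} (λ _ → x) ≡ ι k * x
sum-const zero    x = sym (*-zeroˡ x)
sum-const (suc k) x = trans (cong (λ y → x + y) (sum-const k x)) (trans
  (solve 2 (λ x i → x :+ i :* x := (con 1ℚ :+ i) :* x) refl x (ι k)) (cong (_* x) (sym (ι-suc k))))

sum-0 : ∀ {k} {f : Fin k → ℚ} → (∀ i → f i ≡ 0ℚ) → sum f ≡ 0ℚ
sum-0 {k} f≡0 = trans (sum-cong-≗ f≡0) (sum-replicate-zero k)

0≤sum : ∀ {k} {f : Fin k → ℚ} → (∀ i → 0ℚ ≤ f i) → 0ℚ ≤ sum f
0≤sum {zero}  0≤f = ≤-refl
0≤sum {suc k} 0≤f = 0≤+ (0≤f zero) (0≤sum (0≤f ∘ suc))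

sum-neg : ∀ {k} (f : Fin k → ℚ) → sum (λ i → - f i) ≡ - sum f
sum-neg {zero}  f = refl
sum-neg {suc k} f = trans (cong (λ y → - f zero + y) (sum-neg (f ∘ suc))) (sym (neg-distrib-+ (f zero) _))

sum-minus : ∀ {k} (f g : Fin k → ℚ) → sum (λ i → f i - g i) ≡ sum f - sum g
sum-minus f g = trans (∑-distrib-+ f (λ i → - g i)) (cong (λ y → sum f + y) (sum-neg g))

term≤sum : ∀ {k} {f : Fin k → ℚ} → (∀ i → 0ℚ ≤ f i) → ∀ i → f i ≤ sum f
term≤sum {f = f} 0≤f zero = ≤-by-difference _ (0≤sum (0≤f ∘ suc)) (solve 2 (λ x y → x :+ y :- x := y) refl (f zero) (sum (f ∘ suc)))
term≤sum {f = f} 0≤f (suc i) = ≤-trans (term≤sum (0≤f ∘ suc) i)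
  (≤-by-difference _ (0≤f zero) (solve 2 (λ x y → x :+ y :- y := x) refl (f zero) (sum (f ∘ suc))))

argmax : ∀ {k} .{{_ : NonZero k}} (f : Fin k → ℚ) → ∃[ i ] (∀ j → f j ≤ f i)
argmax {suc zero}      f = zero , λ { zero → ≤-refl }
argmax {suc k@(suc _)} f with argmax {k} (f ∘ suc)
... | i , max with f zero ≤? f (suc i)
...   | yes le = suc i , λ { zero → le ; (suc j) → max j }
...   | no  gt = zero , λ { zero → ≤-refl ; (suc j) → ≤-trans (max j) (<⇒≤ (≰⇒> gt)) }

archimedean : ∀ x → ∃[ N ] x ≤ ι N
archimedean x@(mkℚ (+ m) d _) = m , subst (x ≤_) (sym (ι≡mkℚ m)) (*≤* (subst₂ ℤ._≤_ (ℤ.pos-* m 1) (ℤ.pos-* m (suc d)) (+≤+ (ℕ.*-monoʳ-≤ m {1} (ℕ.s≤s ℕ.z≤n)))))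
archimedean x@(mkℚ ℤ.-[1+ m ] d _) = 0 , *≤* ℤ.-≤+

-- Indicators and sums over lists

𝟙 : Bool → ℚ
𝟙 b = if b then 1ℚ else 0ℚ

0≤𝟙 : ∀ b → 0ℚ ≤ 𝟙 b
0≤𝟙 true  = nonNegative⁻¹ 1ℚ
0≤𝟙 false = ≤-refl

sumᴸ : ∀ {A : Set} → (A → ℚ) → List A → ℚ
sumᴸ f []       = 0ℚ
sumᴸ f (x ∷ xs) = f x + sumᴸ f xs

sum-lookup : ∀ {A : Set} (f : A → ℚ) xs → sum (λ i → f (lookup xs i)) ≡ sumᴸ f xs
sum-lookup f []       = refl
sum-lookup f (x ∷ xs) = cong (λ y → f x + y) (sum-lookup f xs)

sumᴸ-filter : ∀ {A : Set} {P : A → Set} (P? : Decidable P) (f : A → ℚ) xs →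
              sumᴸ f (filter P? xs) ≡ sumᴸ (λ x → 𝟙 (does (P? x)) * f x) xs
sumᴸ-filter P? f []       = refl
sumᴸ-filter P? f (x ∷ xs) with does (P? x)
... | true  = cong₂ _+_ (sym (*-identityˡ (f x))) (sumᴸ-filter P? f xs)
... | false = trans (sumᴸ-filter P? f xs)
  (trans (sym (+-identityˡ _)) (cong (_+ sumᴸ _ xs) (sym (*-zeroˡ (f x)))))

sumᴸ-tabulate : ∀ {A : Set} (f : A → ℚ) {k} (g : Fin k → A) → sumᴸ f (tabulate g) ≡ sum (f ∘ g)
sumᴸ-tabulate f {zero}  g = refl
sumᴸ-tabulate f {suc k} g = cong (λ y → f (g zero) + y) (sumᴸ-tabulate f (g ∘ suc))

sumᴸ-allFin : ∀ {k} (f : Fin k → ℚ) → sumᴸ f (allFin k) ≡ sum f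
sumᴸ-allFin {k} f = sumᴸ-tabulate f {k} id

sumᴸ-1 : ∀ {A : Set} (xs : List A) → sumᴸ (λ _ → 1ℚ) xs ≡ ι (length xs)
sumᴸ-1 []       = refl
sumᴸ-1 (x ∷ xs) = trans (cong (λ y → 1ℚ + y) (sumᴸ-1 xs)) (sym (ι-suc (length xs)))

sumᴸ-++ : ∀ {A : Set} (f : A → ℚ) xs ys → sumᴸ f (xs ++ ys) ≡ sumᴸ f xs + sumᴸ f ys
sumᴸ-++ f []       ys = sym (+-identityˡ _)
sumᴸ-++ f (x ∷ xs) ys = trans (cong (λ y → f x + y) (sumᴸ-++ f xs ys)) (sym (+-assoc (f x) _ _))

sumᴸ-map : ∀ {A B : Set} (f : B → ℚ) (g : A → B) xs → sumᴸ f (map g xs) ≡ sumᴸ (f ∘ g) xs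
sumᴸ-map f g []       = refl
sumᴸ-map f g (x ∷ xs) = cong (λ y → f (g x) + y) (sumᴸ-map f g xs)

sumᴸ-cartesianProduct : ∀ {A B : Set} (f : A × B → ℚ) xs ys →
  sumᴸ f (cartesianProduct xs ys) ≡ sumᴸ (λ x → sumᴸ (λ y → f (x , y)) ys) xs
sumᴸ-cartesianProduct f []       ys = refl
sumᴸ-cartesianProduct f (x ∷ xs) ys = trans (sumᴸ-++ f (map (x ,_) ys) _)
  (cong₂ _+_ (sumᴸ-map f (x ,_) ys) (sumᴸ-cartesianProduct f xs ys))

-- Expectation in finite experiments

𝔼-cong : ∀ {A} (m : Random A) {f g} → (∀ x → f x ≡ g x) → 𝔼 m f ≡ 𝔼 m g
𝔼-cong (pure x)   f≡g = f≡g x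
𝔼-cong (pick k m) f≡g = cong (λ y → (+ 1 / k) * y) (sum-cong-≗ λ i → 𝔼-cong (m i) f≡g)

𝔼-mono : ∀ {A} (m : Random A) {f g} → (∀ x → f x ≤ g x) → 𝔼 m f ≤ 𝔼 m g
𝔼-mono (pure x)   f≤g = f≤g x
𝔼-mono (pick k m) f≤g = *-monoˡ (<⇒≤ (0<1/k k)) (sum-mono λ i → 𝔼-mono (m i) f≤g)

𝔼-const : ∀ {A} (m : Random A) c → 𝔼 m (λ _ → c) ≡ c
𝔼-const (pure x)   c = refl
𝔼-const (pick k m) c = begin
  (+ 1 / k) * sum (λ i → 𝔼 (m i) (λ _ → c)) ≡⟨ cong (λ y → (+ 1 / k) * y) (trans (sum-cong-≗ λ i → 𝔼-const (m i) c) (sum-const k c)) ⟩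
  (+ 1 / k) * (ι k * c)                     ≡⟨ *-assoc (+ 1 / k) (ι k) c ⟨
  (+ 1 / k) * ι k * c                       ≡⟨ cong (_* c) (1/k*k≡1 k) ⟩
  1ℚ * c                                    ≡⟨ *-identityˡ c ⟩
  c                                         ∎
  where open ≡-Reasoning

𝔼-+ : ∀ {A} (m : Random A) f g → 𝔼 m (λ x → f x + g x) ≡ 𝔼 m f + 𝔼 m g
𝔼-+ (pure x)   f g = refl
𝔼-+ (pick k m) f g = trans
  (cong (λ y → (+ 1 / k) * y) (trans (sum-cong-≗ λ i → 𝔼-+ (m i) f g) (∑-distrib-+ (λ i → 𝔼 (m i) f) (λ i → 𝔼 (m i) g))))
  (*-distribˡ-+ (+ 1 / k) _ _)

𝔼-* : ∀ {A} (m : Random A) c f → 𝔼 m (λ x → c * f x) ≡ c * 𝔼 m f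
𝔼-* (pure x)   c f = refl
𝔼-* (pick k m) c f = trans
  (cong (λ y → (+ 1 / k) * y) (trans (sum-cong-≗ λ i → 𝔼-* (m i) c f) (sym (*-distribˡ-sum c (λ i → 𝔼 (m i) f)))))
  (solve 3 (λ k c s → k :* (c :* s) := c :* (k :* s)) refl (+ 1 / k) c _)

𝔼-minus : ∀ {A} (m : Random A) f g → 𝔼 m (λ x → f x - g x) ≡ 𝔼 m f - 𝔼 m g
𝔼-minus m f g = begin
  𝔼 m (λ x → f x - g x)             ≡⟨ 𝔼-cong m (λ x → cong (λ y → f x + y) (solve 1 (λ y → :- y := con (- 1ℚ) :* y) refl (g x))) ⟩
  𝔼 m (λ x → f x + (- 1ℚ) * g x)    ≡⟨ 𝔼-+ m f _ ⟩
  𝔼 m f + 𝔼 m (λ x → (- 1ℚ) * g x)  ≡⟨ cong (λ y → 𝔼 m f + y) (trans (𝔼-* m (- 1ℚ) g) (solve 1 (λ y → con (- 1ℚ) :* y := :- y) refl (𝔼 m g))) ⟩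
  𝔼 m f - 𝔼 m g                     ∎
  where open ≡-Reasoning

𝔼-sum : ∀ {A} (m : Random A) {k} (f : Fin k → A → ℚ) → 𝔼 m (λ x → sum (λ i → f i x)) ≡ sum (λ i → 𝔼 m (f i))
𝔼-sum m {zero}  f = 𝔼-const m 0ℚ
𝔼-sum m {suc k} f = trans (𝔼-+ m (f zero) _) (cong (λ y → 𝔼 m (f zero) + y) (𝔼-sum m (f ∘ suc)))

𝔼->>= : ∀ {A B} (m : Random A) (f : A → Random B) g → 𝔼 (m >>= f) g ≡ 𝔼 m (λ x → 𝔼 (f x) g)
𝔼->>= (pure x)   f g = refl
𝔼->>= (pick k m) f g = cong (λ y → (+ 1 / k) * y) (sum-cong-≗ λ i → 𝔼->>= (m i) f g)

-- Linearity of expectation, peeled off one call at a time. It turns the expected drop in one round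
-- into a sum over the informed vertices.
𝔼-independently : ∀ {A B : Set} (f : A → Random B) (g : B → ℚ) xs →
                  𝔼 (independently f xs) (sumᴸ g) ≡ sumᴸ (λ x → 𝔼 (f x) g) xs
𝔼-independently f g []       = refl
𝔼-independently f g (x ∷ xs) = begin
  𝔼 (independently f (x ∷ xs)) (sumᴸ g)
    ≡⟨ 𝔼->>= (f x) _ _ ⟩
  𝔼 (f x) (λ y → 𝔼 (independently f xs >>= λ ys → pure (y ∷ ys)) (sumᴸ g))
    ≡⟨ 𝔼-cong (f x) (λ y → trans (𝔼->>= (independently f xs) _ _) (trans (𝔼-+ (independently f xs) (λ _ → g y) (sumᴸ g)) (cong₂ _+_ (𝔼-const (independently f xs) (g y)) (𝔼-independently f g xs)))) ⟩
  𝔼 (f x) (λ y → g y + sumᴸ (λ x → 𝔼 (f x) g) xs)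
    ≡⟨ trans (𝔼-+ (f x) g _) (cong (λ y → 𝔼 (f x) g + y) (𝔼-const (f x) _)) ⟩
  𝔼 (f x) g + sumᴸ (λ x → 𝔼 (f x) g) xs ∎
  where open ≡-Reasoning

𝔼-trajectory : ∀ {S} (step : S → Random S) x N (T : List S → ℚ) →
  𝔼 (trajectory step x (suc N)) T ≡ 𝔼 (step x) (λ y → 𝔼 (trajectory step y N) (λ ω → T (x ∷ ω)))
𝔼-trajectory step x N T = trans (𝔼->>= (step x) _ T) (𝔼-cong (step x) λ y → 𝔼->>= (trajectory step y N) _ T)

-- First passage times and their truncations

module _ {S : Set} {P : S → Set} (P? : Decidable P) where

  firstTime-here : ∀ {x} → P x → ∀ ω → firstTime P? (x ∷ ω) ≡ 0
  firstTime-here {x} Px ω with P? x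
  ... | yes _  = refl
  ... | no ¬Px = contradiction Px ¬Px

  firstTime-there : ∀ {x} → ¬ P x → ∀ ω → firstTime P? (x ∷ ω) ≡ suc (firstTime P? ω)
  firstTime-there {x} ¬Px ω with P? x
  ... | yes Px = contradiction Px ¬Px
  ... | no _   = refl

module _ {S : Set} (step : S → Random S) where

  𝔼time : (List S → ℕ) → ℕ → S → ℚ
  𝔼time T N x = 𝔼 (trajectory step x N) λ ω → ι (T ω)

  0≤𝔼time : ∀ T N x → 0ℚ ≤ 𝔼time T N x
  0≤𝔼time T N x = subst (_≤ 𝔼time T N x) (𝔼-const (trajectory step x N) 0ℚ) (𝔼-mono (trajectory step x N) λ ω → 0≤ι (T ω))

  𝔼time-zero : ∀ T {x} → (∀ ω → T (x ∷ ω) ≡ 0) → ∀ N → 𝔼time T (suc N) x ≡ 0ℚ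
  𝔼time-zero T {x} T≡0 N = begin
    𝔼time T (suc N) x                                                   ≡⟨ 𝔼-trajectory step x N (λ ω → ι (T ω)) ⟩
    𝔼 (step x) (λ y → 𝔼 (trajectory step y N) (λ ω → ι (T (x ∷ ω))))    ≡⟨ 𝔼-cong (step x) (λ y → 𝔼-cong (trajectory step y N) λ ω → cong ι (T≡0 ω)) ⟩
    𝔼 (step x) (λ y → 𝔼 (trajectory step y N) (λ ω → 0ℚ))               ≡⟨ 𝔼-cong (step x) (λ y → 𝔼-const (trajectory step y N) 0ℚ) ⟩
    𝔼 (step x) (λ y → 0ℚ)                                               ≡⟨ 𝔼-const (step x) 0ℚ ⟩
    0ℚ                                                                  ∎
    where open ≡-Reasoning

  -- First-step analysis. `T` and `T′` may differ because the time that remains until all vertices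
  -- are visited depends on the set visited so far.
  𝔼time-suc : ∀ T T′ {x} → (∀ ω → T (x ∷ ω) ≡ suc (T′ ω)) → ∀ N → 𝔼time T (suc N) x ≡ 1ℚ + 𝔼 (step x) (𝔼time T′ N)
  𝔼time-suc T T′ {x} T≡suc N = begin
    𝔼time T (suc N) x                                                   ≡⟨ 𝔼-trajectory step x N (λ ω → ι (T ω)) ⟩
    𝔼 (step x) (λ y → 𝔼 (trajectory step y N) (λ ω → ι (T (x ∷ ω))))    ≡⟨ 𝔼-cong (step x) (λ y → 𝔼-cong (trajectory step y N) λ ω → trans (cong ι (T≡suc ω)) (ι-suc (T′ ω))) ⟩
    𝔼 (step x) (λ y → 𝔼 (trajectory step y N) (λ ω → 1ℚ + ι (T′ ω)))    ≡⟨ 𝔼-cong (step x) (λ y → 1+ (trajectory step y N) (λ ω → ι (T′ ω))) ⟩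
    𝔼 (step x) (λ y → 1ℚ + 𝔼time T′ N y)                                ≡⟨ 1+ (step x) (𝔼time T′ N) ⟩
    1ℚ + 𝔼 (step x) (𝔼time T′ N)                                        ∎
    where
    open ≡-Reasoning
    1+ : ∀ {A} (m : Random A) f → 𝔼 m (λ x → 1ℚ + f x) ≡ 1ℚ + 𝔼 m f
    1+ m f = trans (𝔼-+ m (λ _ → 1ℚ) f) (cong (_+ 𝔼 m f) (𝔼-const m 1ℚ))

module Hitting {S : Set} (step : S → Random S) {P : S → Set} (P? : Decidable P) where

  𝔼min : ℕ → S → ℚ
  𝔼min = 𝔼time step (firstTime P?)

  𝔼min-here : ∀ N {x} → P x → 𝔼min N x ≡ 0ℚ
  𝔼min-here zero    Px = refl
  𝔼min-here (suc N) Px = 𝔼time-zero step (firstTime P?) (firstTime-here P? Px) N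

  𝔼min-suc : ∀ N {x} → ¬ P x → 𝔼min (suc N) x ≡ 1ℚ + 𝔼 (step x) (𝔼min N)
  𝔼min-suc N ¬Px = 𝔼time-suc step (firstTime P?) (firstTime P?) (firstTime-there P? ¬Px) N

  -- The probability that T ≥ N, that is, that none of X₀, ..., X_{N-1} satisfies `P`; the recursion
  -- is by first steps, in parallel with that of `𝔼min`.
  survive : ℕ → S → ℚ
  survive zero    x = 1ℚ
  survive (suc N) x = if does (P? x) then 0ℚ else 𝔼 (step x) (survive N)

  survive-here : ∀ N {x} → P x → survive (suc N) x ≡ 0ℚ
  survive-here N {x} Px = cong (if_then 0ℚ else 𝔼 (step x) (survive N)) (dec-true (P? x) Px)

  survive-suc : ∀ N {x} → ¬ P x → survive (suc N) x ≡ 𝔼 (step x) (survive N)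
  survive-suc N {x} ¬Px = cong (if_then 0ℚ else 𝔼 (step x) (survive N)) (dec-false (P? x) ¬Px)

  0≤survive : ∀ N x → 0ℚ ≤ survive N x
  0≤survive zero    x = nonNegative⁻¹ 1ℚ
  0≤survive (suc N) x with does (P? x)
  ... | true  = ≤-refl
  ... | false = subst (_≤ 𝔼 (step x) (survive N)) (𝔼-const (step x) 0ℚ) (𝔼-mono (step x) (0≤survive N))

  survive≤1 : ∀ N x → survive N x ≤ 1ℚ
  survive≤1 zero    x = ≤-refl
  survive≤1 (suc N) x with does (P? x)
  ... | true  = nonNegative⁻¹ 1ℚ
  ... | false = subst (𝔼 (step x) (survive N) ≤_) (𝔼-const (step x) 1ℚ) (𝔼-mono (step x) (survive≤1 N))

  -- Markov's inequality for min(T, N), which equals N on the event T ≥ N. In the induction one of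
  -- the N + 1 copies of the survival probability is paid for by the current step, the other N by
  -- the induction hypothesis.
  markov : ∀ N x → ι N * survive N x ≤ 𝔼min N x
  markov zero    x = ≤-reflexive (*-zeroˡ 1ℚ)
  markov (suc N) x = case P? x of λ where
      (yes Px) → ≤-reflexive (trans (cong (λ y → ι (suc N) * y) (survive-here N Px)) (trans (*-zeroʳ (ι (suc N))) (sym (𝔼min-here (suc N) Px))))
      (no ¬Px) → begin
        ι (suc N) * survive (suc N) x               ≡⟨ cong (λ y → ι (suc N) * y) (survive-suc N ¬Px) ⟩
        ι (suc N) * 𝔼 (step x) (survive N)          ≡⟨ 𝔼-* (step x) (ι (suc N)) (survive N) ⟨
        𝔼 (step x) (λ y → ι (suc N) * survive N y)  ≤⟨ 𝔼-mono (step x) next ⟩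
        𝔼 (step x) (λ y → 1ℚ + 𝔼min N y)            ≡⟨ 𝔼-+ (step x) (λ _ → 1ℚ) (𝔼min N) ⟩
        𝔼 (step x) (λ _ → 1ℚ) + 𝔼 (step x) (𝔼min N) ≡⟨ cong (_+ 𝔼 (step x) (𝔼min N)) (𝔼-const (step x) 1ℚ) ⟩
        1ℚ + 𝔼 (step x) (𝔼min N)                    ≡⟨ 𝔼min-suc N ¬Px ⟨
        𝔼min (suc N) x                              ∎
    where
    open ≤-Reasoning
    next : ∀ y → ι (suc N) * survive N y ≤ 1ℚ + 𝔼min N y
    next y = begin
      ι (suc N) * survive N y          ≡⟨ cong (_* survive N y) (ι-suc N) ⟩
      (1ℚ + ι N) * survive N y         ≡⟨ solve 2 (λ s i → (con 1ℚ :+ i) :* s := s :+ i :* s) refl (survive N y) (ι N) ⟩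
      survive N y + ι N * survive N y  ≤⟨ +-mono-≤ (survive≤1 N y) (markov N y) ⟩
      1ℚ + 𝔼min N y                    ∎

-- Indicators of decidable propositions, and division

𝟙-cong : ∀ {P Q : Set} (P? : Dec P) (Q? : Dec Q) → (P → Q) → (Q → P) → 𝟙 (does P?) ≡ 𝟙 (does Q?)
𝟙-cong (yes _) (yes _) _ _ = refl
𝟙-cong (no _)  (no _)  _ _ = refl
𝟙-cong (yes p) (no ¬q) f _ = contradiction (f p) ¬q
𝟙-cong (no ¬p) (yes q) _ g = contradiction (g q) ¬p

𝟙-yes : ∀ {P : Set} (P? : Dec P) → P → 𝟙 (does P?) ≡ 1ℚ
𝟙-yes P? p = cong 𝟙 (dec-true P? p)

𝟙-no : ∀ {P : Set} (P? : Dec P) → ¬ P → 𝟙 (does P?) ≡ 0ℚ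
𝟙-no P? ¬p = cong 𝟙 (dec-false P? ¬p)

sum-𝟙≡ : ∀ {k} (v : Fin k) → sum (λ u → 𝟙 (does (u Fin.≟ v))) ≡ 1ℚ
sum-𝟙≡ {suc k} zero    = trans (cong (λ y → 1ℚ + y) (sum-0 {k} λ u → refl)) (+-identityʳ 1ℚ)
sum-𝟙≡ {suc k} (suc v) = trans (+-identityˡ _) (trans (sum-cong-≗ λ u → 𝟙-cong (suc u Fin.≟ suc v) (u Fin.≟ v) Fin.suc-injective (cong suc)) (sum-𝟙≡ v))

divide : ∀ a b → b ≢ 0ℚ → ∃[ c ] c * b ≡ a
divide a b b≢0 = a * (1/ b) , trans (*-assoc a (1/ b) b) (trans (cong (a *_) (*-inverseˡ b)) (*-identityʳ a))
  where instance _ = ≢-nonZero b≢0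

-- The graph Laplacian and the Dirichlet problem

module Potential {n : ℕ} (G : Graph n) where
  open Graph G

  A : Fin n → Fin n → ℚ
  A u w = 𝟙 (does (adj? u w))

  A-sym : ∀ u w → A u w ≡ A w u
  A-sym u w = 𝟙-cong (adj? u w) (adj? w u) symmetric symmetric

  deg : Fin n → ℚ
  deg u = ι (degree u)

  sum-neighbours : ∀ u f → sumᴸ f (neighbours u) ≡ sum (λ w → A u w * f w)
  sum-neighbours u f = trans (sumᴸ-filter (adj? u) f (allFin n)) (sumᴸ-allFin (λ w → A u w * f w))

  deg≡sum : ∀ u → deg u ≡ sum (A u)
  deg≡sum u = trans (sym (sumᴸ-1 (neighbours u))) (trans (sum-neighbours u (λ _ → 1ℚ)) (sum-cong-≗ λ w → *-identityʳ (A u w)))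

  private
    A⁺ : Fin n → Fin n → ℚ
    A⁺ u w = 𝟙 (does (u Fin.<? w ×-dec adj? u w))

    A≡A⁺+A⁺ : ∀ u w → A u w ≡ A⁺ u w + A⁺ w u
    A≡A⁺+A⁺ u w with Fin.<-cmp u w
    ... | tri< u<w _ w≮u = sym (trans (cong₂ _+_
            (𝟙-cong (u Fin.<? w ×-dec adj? u w) (adj? u w) proj₂ (u<w ,_))
            (𝟙-no (w Fin.<? u ×-dec adj? w u) (w≮u ∘ proj₁))) (+-identityʳ _))
    ... | tri> u≮w _ w<u = sym (trans (cong₂ _+_
            (𝟙-no (u Fin.<? w ×-dec adj? u w) (u≮w ∘ proj₁))
            (𝟙-cong (w Fin.<? u ×-dec adj? w u) (adj? u w) (symmetric ∘ proj₂) (λ e → w<u , symmetric e))) (+-identityˡ _))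
    ... | tri≈ _ refl _ = trans (𝟙-no (adj? u u) (loopless u)) (sym (cong₂ _+_
            (𝟙-no (u Fin.<? u ×-dec adj? u u) (loopless u ∘ proj₂))
            (𝟙-no (u Fin.<? u ×-dec adj? u u) (loopless u ∘ proj₂))))

    ∣E∣≡sum : ι ∣E∣ ≡ sum (λ u → sum (A⁺ u))
    ∣E∣≡sum = begin
      ι ∣E∣
        ≡⟨ sumᴸ-1 edges ⟨
      sumᴸ (λ _ → 1ℚ) edges
        ≡⟨ sumᴸ-filter (λ (u , v) → u Fin.<? v ×-dec adj? u v) (λ _ → 1ℚ) (cartesianProduct (allFin n) (allFin n)) ⟩
      sumᴸ (λ (u , w) → A⁺ u w * 1ℚ) (cartesianProduct (allFin n) (allFin n))
        ≡⟨ sumᴸ-cartesianProduct _ (allFin n) (allFin n) ⟩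
      sumᴸ (λ u → sumᴸ (λ w → A⁺ u w * 1ℚ) (allFin n)) (allFin n)
        ≡⟨ sumᴸ-allFin (λ u → sumᴸ (λ w → A⁺ u w * 1ℚ) (allFin n)) ⟩
      sum (λ u → sumᴸ (λ w → A⁺ u w * 1ℚ) (allFin n))
        ≡⟨ sum-cong-≗ (λ u → trans (sumᴸ-allFin (λ w → A⁺ u w * 1ℚ)) (sum-cong-≗ λ w → *-identityʳ (A⁺ u w))) ⟩
      sum (λ u → sum (A⁺ u)) ∎
      where open ≡-Reasoning

  -- An adjacent pair is increasing in exactly one of its two orders, so `A` is the sum of `A⁺` and
  -- its transpose, and `edges` counts the entries of `A⁺`.
  handshake : sum deg ≡ ι ∣E∣ + ι ∣E∣
  handshake = begin
    sum deg                                          ≡⟨ sum-cong-≗ deg≡sum ⟩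
    sum (λ u → sum (A u))                            ≡⟨ sum-cong-≗ (λ u → trans (sum-cong-≗ (A≡A⁺+A⁺ u)) (∑-distrib-+ (A⁺ u) (λ w → A⁺ w u))) ⟩
    sum (λ u → sum (A⁺ u) + sum (λ w → A⁺ w u))      ≡⟨ ∑-distrib-+ (λ u → sum (A⁺ u)) _ ⟩
    sum (λ u → sum (A⁺ u)) + sum (λ u → sum (λ w → A⁺ w u)) ≡⟨ cong₂ _+_ (sym ∣E∣≡sum) (trans (sym (∑-comm A⁺)) (sym ∣E∣≡sum)) ⟩
    ι ∣E∣ + ι ∣E∣                                    ∎
    where open ≡-Reasoning

  δ≤degree : ∀ u → δ ℕ.≤ degree u
  δ≤degree u = All.lookup (min≤xs n (map degree (allFin n))) (∈-map⁺ degree (∈-allFin u))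

  -- The Laplacian D - A: with `f` read as voltages and unit conductances, `L f u` is the net
  -- current from `u` into the network.
  L : (Fin n → ℚ) → Fin n → ℚ
  L f u = sum (λ w → A u w * (f u - f w))

  L-+ : ∀ f g u → L (λ w → f w + g w) u ≡ L f u + L g u
  L-+ f g u = trans (sum-cong-≗ λ w → solve 5 (λ a x y x' y' → a :* (x :+ y :- (x' :+ y')) := a :* (x :- x') :+ a :* (y :- y')) refl (A u w) (f u) (g u) (f w) (g w))
    (∑-distrib-+ (λ w → A u w * (f u - f w)) (λ w → A u w * (g u - g w)))

  L-* : ∀ c f u → L (λ w → c * f w) u ≡ c * L f u
  L-* c f u = trans (sum-cong-≗ λ w → solve 4 (λ a c x y → a :* (c :* x :- c :* y) := c :* (a :* (x :- y))) refl (A u w) c (f u) (f w))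
    (sym (*-distribˡ-sum c (λ w → A u w * (f u - f w))))

  L-const : ∀ c u → L (λ _ → c) u ≡ 0ℚ
  L-const c u = sum-0 λ w → trans (cong (A u w *_) (+-inverseʳ c)) (*-zeroʳ (A u w))

  L-minus : ∀ f g u → L (λ w → f w - g w) u ≡ L f u - L g u
  L-minus f g u = trans (sum-cong-≗ λ w → solve 5 (λ a x y x' y' → a :* (x :- y :- (x' :- y')) := a :* (x :- x') :- a :* (y :- y')) refl (A u w) (f u) (g u) (f w) (g w))
    (sum-minus (λ w → A u w * (f u - f w)) (λ w → A u w * (g u - g w)))

  L-expand : ∀ f u → L f u ≡ deg u * f u - sum (λ w → A u w * f w)
  L-expand f u = trans (sum-cong-≗ λ w → solve 3 (λ a x y → a :* (x :- y) := x :* a :- a :* y) refl (A u w) (f u) (f w))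
    (trans (sum-minus (λ w → f u * A u w) (λ w → A u w * f w))
      (cong (_- sum (λ w → A u w * f w)) (trans (sym (*-distribˡ-sum (f u) (A u))) (trans (cong (f u *_) (sym (deg≡sum u))) (*-comm (f u) (deg u))))))

  -- Currents cancel edge by edge: by the symmetry of `A` the two double sums agree.
  sum-L : ∀ f → sum (L f) ≡ 0ℚ
  sum-L f = begin
    sum (L f)
      ≡⟨ sum-cong-≗ (λ u → trans (sum-cong-≗ λ w → solve 3 (λ a x y → a :* (x :- y) := a :* x :- a :* y) refl (A u w) (f u) (f w)) (sum-minus (λ w → A u w * f u) (λ w → A u w * f w))) ⟩
    sum (λ u → sum (λ w → A u w * f u) - sum (λ w → A u w * f w))
      ≡⟨ sum-minus (λ u → sum (λ w → A u w * f u)) (λ u → sum (λ w → A u w * f w)) ⟩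
    sum (λ u → sum (λ w → A u w * f u)) - sum (λ u → sum (λ w → A u w * f w))
      ≡⟨ cong (λ s → sum (λ u → sum (λ w → A u w * f u)) - s) (trans (∑-comm (λ u w → A u w * f w)) (sum-cong-≗ λ w → sum-cong-≗ λ u → cong (_* f w) (A-sym u w))) ⟩
    sum (λ u → sum (λ w → A u w * f u)) - sum (λ u → sum (λ w → A u w * f u))
      ≡⟨ +-inverseʳ (sum (λ u → sum (λ w → A u w * f u))) ⟩
    0ℚ ∎
    where open ≡-Reasoning

  module _ {B : Fin n → Set} (B? : ∀ u → Dec (B u)) {b : Fin n} (b∈B : B b) {f : Fin n → ℚ}
           (f≤0 : ∀ u → B u → f u ≤ 0ℚ) (Lf≤0 : ∀ u → ¬ B u → L f u ≤ 0ℚ) where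

    private
      -- A maximum that is positive spreads to the neighbours, hence along
      -- a path to b.
      spread : ∀ {u} → Star Adj u b → (∀ w → f w ≤ f u) → f u ≤ 0ℚ
      spread ε max = f≤0 _ b∈B
      spread {u} (_◅_ {j = w} e p) max with B? u
      ... | yes Bu = f≤0 u Bu
      ... | no ¬Bu = ≤-trans fu≤fw (spread p (λ x → ≤-trans (max x) fu≤fw))
        where
        -- At a maximum every term of `L f u` is non-negative, so the term of `w` alone is at most
        -- the whole sum, which is at most 0 outside `B`.
        fu-fw≤0 : f u - f w ≤ 0ℚ
        fu-fw≤0 = begin
          f u - f w           ≡⟨ *-identityˡ _ ⟨
          1ℚ * (f u - f w)    ≡⟨ cong (_* (f u - f w)) (𝟙-yes (adj? u w) e) ⟨
          A u w * (f u - f w) ≤⟨ term≤sum (λ x → 0≤* (0≤𝟙 (does (adj? u x))) (x≤y⇒0≤y-x (max x))) w ⟩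
          L f u               ≤⟨ Lf≤0 u ¬Bu ⟩
          0ℚ                  ∎
          where open ≤-Reasoning
        fu≤fw : f u ≤ f w
        fu≤fw = ≤-by-difference (0ℚ - (f u - f w)) (x≤y⇒0≤y-x fu-fw≤0) (solve 2 (λ x y → y :- x := con 0ℚ :- (x :- y)) refl (f u) (f w))

    maximum-principle : ∀ u → f u ≤ 0ℚ
    maximum-principle u with argmax {{Fin.nonZeroIndex u}} f
    ... | x , max = ≤-trans (max u) (spread (connected x b) max)

  -- The Poisson equation with zero boundary values on `B`. The source `deg` gives the hitting times
  -- of `B`; a unit source at `v` gives the potential of a unit current from `v` to `B`.
  Solves : (B : Fin n → Set) (g f : Fin n → ℚ) → Set
  Solves B g f = (∀ u → B u → f u ≡ 0ℚ) × (∀ u → ¬ B u → L f u ≡ g u)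

  -- Uniqueness for the Dirichlet problem: the maximum principle applies to `f` and to its negative.
  harmonic⇒0 : ∀ {B : Fin n → Set} (B? : ∀ u → Dec (B u)) {b} → B b → ∀ {f} →
               Solves B (λ _ → 0ℚ) f → ∀ u → f u ≡ 0ℚ
  harmonic⇒0 B? b∈B {f} (f≡0 , Lf≡0) u = ≤-antisym
    (maximum-principle B? b∈B (λ u → ≤-reflexive ∘ f≡0 u) (λ u → ≤-reflexive ∘ Lf≡0 u) u)
    (≤-by-difference _ (x≤y⇒0≤y-x (maximum-principle B? b∈B {f = λ w → (- 1ℚ) * f w}
        (λ u Bu → ≤-reflexive (trans (cong ((- 1ℚ) *_) (f≡0 u Bu)) (*-zeroʳ (- 1ℚ))))
        (λ u ¬Bu → ≤-reflexive (trans (L-* (- 1ℚ) f u) (trans (cong ((- 1ℚ) *_) (Lf≡0 u ¬Bu)) (*-zeroʳ (- 1ℚ))))) u))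
      (solve 1 (λ x → x :- con 0ℚ := con 0ℚ :- con (- 1ℚ) :* x) refl (f u)))

  Solvable : (Fin n → Set) → Set
  Solvable B = ∀ g → ∃[ f ] Solves B g f

  module _ {B B′ : Fin n → Set} (B′? : ∀ u → Dec (B′ u)) {b} (b∈B′ : B′ b) {x} (x∉B′ : ¬ B′ x)
           (B′⊆B : ∀ {u} → B′ u → B u) (x∈B : B x) (B⊆ : ∀ {u} → B u → u ≡ x ⊎ B′ u) where

    private
      ∉B′ : ∀ u → ¬ B′ u → u ≡ x ⊎ ¬ B u
      ∉B′ u ¬B′u with u Fin.≟ x
      ... | yes u≡x = inj₁ u≡x
      ... | no  u≢x = inj₂ λ Bu → contradiction (B⊆ Bu) λ { (inj₁ u≡x) → u≢x u≡x ; (inj₂ B′u) → ¬B′u B′u }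

      e : Fin n → ℚ
      e u = 𝟙 (does (u Fin.≟ x))

      -- The indicator `e` has the right boundary values; adding a solution with source -L e makes
      -- it harmonic outside `B` and leaves these values alone.
      harmonicAt : Solvable B → ∃[ χ ] (∀ u → B′ u → χ u ≡ 0ℚ) × χ x ≡ 1ℚ × (∀ u → ¬ B u → L χ u ≡ 0ℚ)
      harmonicAt solB with solB (λ u → - L e u)
      ... | f , f≡0 , Lf = (λ u → f u + e u)
        , (λ u B′u → cong₂ _+_ (f≡0 u (B′⊆B B′u)) (𝟙-no (u Fin.≟ x) λ { refl → x∉B′ B′u }))
        , cong₂ _+_ (f≡0 x x∈B) (𝟙-yes (x Fin.≟ x) refl)
        , λ u ¬Bu → trans (L-+ f e u) (trans (cong (_+ L e u) (Lf u ¬Bu)) (+-inverseˡ (L e u)))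

      -- If `χ` were harmonic at `x` as well, it would be harmonic outside `B′` and hence 0, but it
      -- is 1 at `x`.
      nonharmonic : ∀ {χ} → (∀ u → B′ u → χ u ≡ 0ℚ) → χ x ≡ 1ℚ → (∀ u → ¬ B u → L χ u ≡ 0ℚ) → L χ x ≢ 0ℚ
      nonharmonic {χ} χ≡0 χx≡1 Lχ≡0 Lχx≡0 = 1≢0 (trans (sym χx≡1) (harmonic⇒0 B′? b∈B′ (χ≡0 , harm) x))
        where
        harm : ∀ u → ¬ B′ u → L χ u ≡ 0ℚ
        harm u ¬B′u = case ∉B′ u ¬B′u of λ where
          (inj₁ u≡x) → trans (cong (L χ) u≡x) Lχx≡0
          (inj₂ ¬Bu) → Lχ≡0 u ¬Bu

      -- The solution for B and g is corrected at x by a multiple of the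
      -- function χ that is harmonic outside B, 0 on B′ and 1 at x.
      corrected : ∀ {g ψ χ c} → Solves B g ψ → (∀ u → B′ u → χ u ≡ 0ℚ) → (∀ u → ¬ B u → L χ u ≡ 0ℚ) →
                c * L χ x ≡ g x - L ψ x → Solves B′ g (λ u → ψ u + c * χ u)
      corrected {g} {ψ} {χ} {c} (ψ≡0 , Lψ) χ≡0 Lχ≡0 eq = φ≡0 , Lφ≡g
        where
        φ : Fin n → ℚ
        φ u = ψ u + c * χ u
        φ≡0 : ∀ u → B′ u → φ u ≡ 0ℚ
        φ≡0 u B′u = trans (cong₂ _+_ (ψ≡0 u (B′⊆B B′u)) (trans (cong (c *_) (χ≡0 u B′u)) (*-zeroʳ c))) (+-identityˡ 0ℚ)
        Lφ : ∀ u → L φ u ≡ L ψ u + c * L χ u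
        Lφ u = trans (L-+ ψ (λ w → c * χ w) u) (cong (λ y → L ψ u + y) (L-* c χ u))
        Lφ≡g : ∀ u → ¬ B′ u → L φ u ≡ g u
        Lφ≡g u ¬B′u = case ∉B′ u ¬B′u of λ where
          (inj₁ refl) → trans (Lφ x) (trans (cong (λ y → L ψ x + y) eq) (solve 2 (λ p g → p :+ (g :- p) := g) refl (L ψ x) (g x)))
          (inj₂ ¬Bu)  → trans (Lφ u) (trans (cong₂ _+_ (Lψ u ¬Bu) (trans (cong (c *_) (Lχ≡0 u ¬Bu)) (*-zeroʳ c))) (+-identityʳ (g u)))

    -- Releasing the boundary vertex `x` adds a single equation, the one at `x`. It is linear in the
    -- multiple `c` of `χ`, with the non-zero coefficient `L χ x`.
    solvable-remove : Solvable B → Solvable B′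
    solvable-remove solB g =
      let ψ , ψ-solves = solB g
          χ , χ≡0 , χx≡1 , Lχ≡0 = harmonicAt solB
          c , eq = divide (g x - L ψ x) (L χ x) (nonharmonic χ≡0 χx≡1 Lχ≡0)
      in (λ u → ψ u + c * χ u) , corrected {c = c} ψ-solves χ≡0 Lχ≡0 eq

  solvable-cong : ∀ {B B′ : Fin n → Set} → (∀ {u} → B′ u → B u) → (∀ {u} → B u → B′ u) → Solvable B → Solvable B′
  solvable-cong B′⊆B B⊆B′ solB g with solB g
  ... | f , f≡0 , Lf≡g = f , (λ u → f≡0 u ∘ B′⊆B) , (λ u ¬B′u → Lf≡g u (¬B′u ∘ B⊆B′))

  -- With every vertex on the boundary the zero function is a solution; the vertices outside `B` are
  -- then released one at a time.
  solvable : ∀ {B : Fin n → Set} (B? : ∀ u → Dec (B u)) {b} → B b → Solvable B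
  solvable {B} B? {b} b∈B = solvable-cong inj₁ (λ { (inj₁ Bu) → Bu ; (inj₂ ()) }) (go (allFin n) all)
    where
    _∪ᴸ_ : (Fin n → Set) → List (Fin n) → Fin n → Set
    (B ∪ᴸ xs) u = B u ⊎ u ∈ₗ xs
    ∪ᴸ? : ∀ xs u → Dec ((B ∪ᴸ xs) u)
    ∪ᴸ? xs u = B? u ⊎-dec ListMembership._∈?_ Fin._≟_ u xs
    all : Solvable (B ∪ᴸ allFin n)
    all g = (λ _ → 0ℚ) , (λ _ _ → refl) , λ u ∉ → contradiction (inj₂ (∈-allFin u)) ∉
    go : ∀ xs → Solvable (B ∪ᴸ xs) → Solvable (B ∪ᴸ [])
    go []       sol = sol
    go (x ∷ xs) sol with ∪ᴸ? xs x
    -- A vertex that lies in `B` or occurs again in `xs` is still on the boundary, so the boundary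
    -- does not change.
    ... | yes x∈ = go xs (solvable-cong (λ { (inj₁ Bu) → inj₁ Bu ; (inj₂ u∈) → inj₂ (there u∈) })
                       (λ { (inj₁ Bu) → inj₁ Bu ; (inj₂ (here refl)) → x∈ ; (inj₂ (there u∈)) → inj₂ u∈ }) sol)
    ... | no  x∉ = go xs (solvable-remove (∪ᴸ? xs) (inj₁ b∈B) x∉
                       (λ { (inj₁ Bu) → inj₁ Bu ; (inj₂ u∈) → inj₂ (there u∈) }) (inj₂ (here refl))
                       (λ { (inj₁ Bu) → inj₂ (inj₁ Bu) ; (inj₂ (here eq)) → inj₁ eq ; (inj₂ (there u∈)) → inj₂ (inj₂ u∈) }) sol)

sumᴸ-nonNeg : ∀ {A : Set} {f : A → ℚ} → (∀ x → 0ℚ ≤ f x) → ∀ xs → 0ℚ ≤ sumᴸ f xs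
sumᴸ-nonNeg 0≤f []       = ≤-refl
sumᴸ-nonNeg 0≤f (x ∷ xs) = 0≤+ (0≤f x) (sumᴸ-nonNeg 0≤f xs)

sumᴸ-mem : ∀ {A : Set} {f : A → ℚ} → (∀ x → 0ℚ ≤ f x) → ∀ {x xs} → x ∈ₗ xs → f x ≤ sumᴸ f xs
sumᴸ-mem {f = f} 0≤f {x} {xs = _ ∷ xs} (here refl) = subst (_≤ f x + sumᴸ f xs) (+-identityʳ (f x)) (+-monoʳ-≤ (f x) (sumᴸ-nonNeg 0≤f xs))
sumᴸ-mem {f = f} 0≤f {x} {xs = y ∷ xs} (there x∈xs) = ≤-trans (sumᴸ-mem 0≤f x∈xs) (subst (_≤ f y + sumᴸ f xs) (+-identityˡ (sumᴸ f xs)) (+-monoˡ-≤ (sumᴸ f xs) (0≤f y)))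

-- Comparison of potentials and the commute time identity

module _ {n : ℕ} (G : Graph n) where
  open Graph G
  open Potential G

  module _ {B : Fin n → Set} (B? : ∀ u → Dec (B u)) {b : Fin n} (b∈B : B b) where

    -- The maximum principle for -f, whose Laplacian -g is at most 0 outside `B`.
    solution-nonNeg : ∀ {g f} → Solves B g f → (∀ u → 0ℚ ≤ g u) → ∀ u → 0ℚ ≤ f u
    solution-nonNeg {g} {f} (f≡0 , Lf≡g) 0≤g u =
      ≤-by-difference _ (x≤y⇒0≤y-x (maximum-principle B? b∈B {f = λ w → 0ℚ - f w}
        (λ u Bu → ≤-reflexive (cong (λ y → 0ℚ - y) (f≡0 u Bu)))
        (λ u ¬Bu → ≤-by-difference (g u) (0≤g u) (trans (cong (λ y → 0ℚ - y) (trans (L-minus (λ _ → 0ℚ) f u) (cong₂ _-_ (L-const 0ℚ u) (Lf≡g u ¬Bu))))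
            (solve 1 (λ x → con 0ℚ :- (con 0ℚ :- x) := x) refl (g u)))) u))
        (solve 1 (λ x → x :- con 0ℚ := con 0ℚ :- (con 0ℚ :- x)) refl (f u))

    -- Equal sources cancel: f - g - c is harmonic outside `B` and at most 0 on `B`.
    comparison : ∀ f g {c} → (∀ u → B u → f u - g u ≤ c) → (∀ u → ¬ B u → L f u ≡ L g u) → ∀ u → f u - g u ≤ c
    comparison f g {c} f-g≤c Lf≡Lg u =
      ≤-by-difference _ (x≤y⇒0≤y-x (maximum-principle B? b∈B {f = λ w → f w - g w - c}
        (λ u Bu → ≤-by-difference _ (x≤y⇒0≤y-x (f-g≤c u Bu)) (solve 2 (λ x c → con 0ℚ :- (x :- c) := c :- x) refl (f u - g u) c))
        (λ u ¬Bu → ≤-reflexive (begin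
          L (λ w → f w - g w - c) u             ≡⟨ L-minus (λ w → f w - g w) (λ _ → c) u ⟩
          L (λ w → f w - g w) u - L (λ _ → c) u ≡⟨ cong₂ _-_ (L-minus f g u) (L-const c u) ⟩
          L f u - L g u - 0ℚ                    ≡⟨ cong (λ x → x - L g u - 0ℚ) (Lf≡Lg u ¬Bu) ⟩
          L g u - L g u - 0ℚ                    ≡⟨ solve 1 (λ x → x :- x :- con 0ℚ := con 0ℚ) refl (L g u) ⟩
          0ℚ                                    ∎)) u))
        (solve 2 (λ x c → c :- x := con 0ℚ :- (x :- c)) refl (f u - g u) c)
      where open ≡-Reasoning

  point : Fin n → Fin n → ℚ
  point v u = 𝟙 (does (u Fin.≟ v))

  0≤point : ∀ v u → 0ℚ ≤ point v u
  0≤point v u = 0≤𝟙 (does (u Fin.≟ v))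

  2∣E∣ : ℚ
  2∣E∣ = ι ∣E∣ + ι ∣E∣

  -- Off the target the Laplacian is prescribed. Its value at `v` is forced, because all its values
  -- sum to 0 while the degrees sum to 2|E|.
  L-target : ∀ {v h} → Solves (_≡ v) deg h → ∀ u → L h u ≡ deg u - 2∣E∣ * point v u
  L-target {v} {h} (h≡0 , Lh) u = trans (Lh≡ u) (trans (cong (λ y → deg u + y * point v u) k≡)
      (solve 3 (λ d e p → d :+ (:- e) :* p := d :- e :* p) refl (deg u) 2∣E∣ (point v u)))
    where
    k = L h v - deg v
    Lh≡ : ∀ u → L h u ≡ deg u + k * point v u
    Lh≡ u = case u Fin.≟ v of λ where
      (yes refl) → trans (solve 2 (λ l d → l := d :+ (l :- d) :* con 1ℚ) refl (L h v) (deg v)) (cong (λ p → deg v + k * p) (sym (𝟙-yes (v Fin.≟ v) refl)))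
      (no u≢v)   → trans (Lh u u≢v) (trans (solve 2 (λ d k → d := d :+ k :* con 0ℚ) refl (deg u) k) (cong (λ p → deg u + k * p) (sym (𝟙-no (u Fin.≟ v) u≢v))))
    total : 2∣E∣ + k ≡ 0ℚ
    total = begin
      2∣E∣ + k                                     ≡⟨ cong₂ _+_ handshake (trans (cong (k *_) (sum-𝟙≡ v)) (*-identityʳ k)) ⟨
      sum deg + k * sum (point v)                  ≡⟨ cong (λ y → sum deg + y) (*-distribˡ-sum k (point v)) ⟩
      sum deg + sum (λ u → k * point v u)          ≡⟨ ∑-distrib-+ deg (λ u → k * point v u) ⟨
      sum (λ u → deg u + k * point v u)            ≡⟨ sum-cong-≗ Lh≡ ⟨
      sum (L h)                                    ≡⟨ sum-L h ⟩
      0ℚ                                           ∎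
      where open ≡-Reasoning
    k≡ : k ≡ - 2∣E∣
    k≡ = trans (solve 2 (λ k e → k := (e :+ k) :- e) refl k 2∣E∣) (trans (cong (_- 2∣E∣) total) (+-identityˡ (- 2∣E∣)))

  -- Outside `s` the Laplacian of hᵥ - hₛ is -2|E| at `v` and 0 elsewhere. Adding 2|E| φ and
  -- shifting by a constant gives a function that is harmonic outside `s` and 0 at `s`, hence 0; the
  -- identity is its value at `v`.
  commute≡resistance : ∀ {s v hᵥ hₛ φ} → Solves (_≡ v) deg hᵥ → Solves (_≡ s) deg hₛ → Solves (_≡ s) (point v) φ →
                       hᵥ s + hₛ v ≡ 2∣E∣ * φ v
  commute≡resistance {s} {v} {hᵥ} {hₛ} {φ} solᵥ solₛ (φ≡0 , Lφ) = begin
    hᵥ s + hₛ v              ≡⟨ solve 5 (λ a b c d e → a :+ b := e :- (d :- b :- (a :- c) :+ e) :+ d :+ c) refl (hᵥ s) (hₛ v) (hₛ s) (hᵥ v) (2∣E∣ * φ v) ⟩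
    2∣E∣ * φ v - ρ v + hᵥ v + hₛ s ≡⟨ cong₂ _+_ (cong₂ _+_ (cong (λ y → 2∣E∣ * φ v - y) (harmonic⇒0 (Fin._≟ s) refl (ρ≡0 , Lρ≡0) v)) (proj₁ solᵥ v refl)) (proj₁ solₛ s refl) ⟩
    2∣E∣ * φ v - 0ℚ + 0ℚ + 0ℚ ≡⟨ solve 1 (λ x → x :- con 0ℚ :+ con 0ℚ :+ con 0ℚ := x) refl (2∣E∣ * φ v) ⟩
    2∣E∣ * φ v               ∎
    where
    open ≡-Reasoning
    ρ : Fin n → ℚ
    ρ u = hᵥ u - hₛ u - (hᵥ s - hₛ s) + 2∣E∣ * φ u
    ρ≡0 : ∀ u → u ≡ s → ρ u ≡ 0ℚ
    ρ≡0 u refl = trans (cong (λ y → hᵥ u - hₛ u - (hᵥ u - hₛ u) + 2∣E∣ * y) (φ≡0 u refl))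
      (solve 2 (λ x e → x :- x :+ e :* con 0ℚ := con 0ℚ) refl (hᵥ u - hₛ u) 2∣E∣)
    Lρ≡0 : ∀ u → u ≢ s → L ρ u ≡ 0ℚ
    Lρ≡0 u u≢s = begin
      L ρ u
        ≡⟨ L-+ (λ u → hᵥ u - hₛ u - (hᵥ s - hₛ s)) (λ u → 2∣E∣ * φ u) u ⟩
      L (λ u → hᵥ u - hₛ u - (hᵥ s - hₛ s)) u + L (λ u → 2∣E∣ * φ u) u
        ≡⟨ cong₂ _+_ (trans (L-minus (λ u → hᵥ u - hₛ u) (λ _ → hᵥ s - hₛ s) u) (cong₂ _-_ (L-minus hᵥ hₛ u) (L-const (hᵥ s - hₛ s) u))) (L-* 2∣E∣ φ u) ⟩
      L hᵥ u - L hₛ u - 0ℚ + 2∣E∣ * L φ u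
        ≡⟨ cong₂ (λ x y → x - 0ℚ + 2∣E∣ * y) (cong₂ _-_ (L-target solᵥ u) (proj₂ solₛ u u≢s)) (Lφ u u≢s) ⟩
      deg u - 2∣E∣ * point v u - deg u - 0ℚ + 2∣E∣ * point v u
        ≡⟨ solve 2 (λ d x → d :- x :- d :- con 0ℚ :+ x := con 0ℚ) refl (deg u) (2∣E∣ * point v u) ⟩
      0ℚ ∎

-- One step of the walk and hitting times

module _ {n : ℕ} .{{_ : NonTrivial n}} (G : Graph n) where
  open Graph G
  open Potential G

  deg⁻¹ : Fin n → ℚ
  deg⁻¹ u = (+ 1 / degree u) {{degree-nonZero G u}}

  δ⁻¹ : ℚ
  δ⁻¹ = (+ 1 / δ) {{δ-nonZero G}}

  deg⁻¹*deg : ∀ u → deg⁻¹ u * deg u ≡ 1ℚ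
  deg⁻¹*deg u = 1/k*k≡1 (degree u) {{degree-nonZero G u}}

  δ⁻¹*δ : δ⁻¹ * ι δ ≡ 1ℚ
  δ⁻¹*δ = 1/k*k≡1 δ {{δ-nonZero G}}

  0<deg⁻¹ : ∀ u → 0ℚ < deg⁻¹ u
  0<deg⁻¹ u = 0<1/k (degree u) {{degree-nonZero G u}}

  0<δ⁻¹ : 0ℚ < δ⁻¹
  0<δ⁻¹ = 0<1/k δ {{δ-nonZero G}}

  deg⁻¹≤δ⁻¹ : ∀ u → deg⁻¹ u ≤ δ⁻¹
  deg⁻¹≤δ⁻¹ u = begin
    deg⁻¹ u                 ≡⟨ *-identityʳ _ ⟨
    deg⁻¹ u * 1ℚ            ≡⟨ cong (deg⁻¹ u *_) δ⁻¹*δ ⟨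
    deg⁻¹ u * (δ⁻¹ * ι δ)   ≤⟨ *-monoˡ (<⇒≤ (0<deg⁻¹ u)) (*-monoˡ (<⇒≤ 0<δ⁻¹) (ι-mono (δ≤degree u))) ⟩
    deg⁻¹ u * (δ⁻¹ * deg u) ≡⟨ solve 3 (λ a b c → a :* (b :* c) := b :* (a :* c)) refl (deg⁻¹ u) δ⁻¹ (deg u) ⟩
    δ⁻¹ * (deg⁻¹ u * deg u) ≡⟨ trans (cong (δ⁻¹ *_) (deg⁻¹*deg u)) (*-identityʳ δ⁻¹) ⟩
    δ⁻¹                     ∎
    where open ≤-Reasoning

  -- The transition operator of the walk is 1 - D⁻¹L.
  𝔼-neighbour : ∀ u f → 𝔼 (randomNeighbour G u) f ≡ f u - deg⁻¹ u * L f u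
  𝔼-neighbour u f = begin
    deg⁻¹ u * sum (λ i → f (lookup (neighbours u) i))    ≡⟨ cong (deg⁻¹ u *_) (trans (sum-lookup f (neighbours u)) (sum-neighbours u f)) ⟩
    deg⁻¹ u * sum (λ w → A u w * f w)                    ≡⟨ solve 4 (λ i s d x → i :* s := i :* d :* x :- i :* (d :* x :- s)) refl (deg⁻¹ u) (sum (λ w → A u w * f w)) (deg u) (f u) ⟩
    deg⁻¹ u * deg u * f u - deg⁻¹ u * (deg u * f u - sum (λ w → A u w * f w)) ≡⟨ cong₂ _-_ (trans (cong (_* f u) (deg⁻¹*deg u)) (*-identityˡ (f u))) (cong (deg⁻¹ u *_) (sym (L-expand f u))) ⟩
    f u - deg⁻¹ u * L f u                                ∎
    where open ≡-Reasoning

  𝔼-hitting : ∀ {v h} → Solves (_≡ v) deg h → ∀ {u} → u ≢ v → 𝔼 (randomNeighbour G u) h ≡ h u - 1ℚ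
  𝔼-hitting {h = h} (_ , Lh) {u} u≢v = trans (𝔼-neighbour u h) (cong (λ y → h u - y) (trans (cong (deg⁻¹ u *_) (Lh u u≢v)) (deg⁻¹*deg u)))

  module _ {v : Fin n} {h : Fin n → ℚ} (h-solves : Solves (_≡ v) deg h) where
    open Hitting (randomNeighbour G) (Fin._≟ v)
    open ≤-Reasoning

    hitting-nonNeg : ∀ u → 0ℚ ≤ h u
    hitting-nonNeg = solution-nonNeg G (Fin._≟ v) refl h-solves (λ u → 0≤ι (degree u))

    -- Away from the target `h` satisfies the recursion of `𝔼min` exactly, and it is non-negative,
    -- so it dominates every truncation.
    hitting-bound : ∀ N u → 𝔼min N u ≤ h u
    hitting-bound zero    u = hitting-nonNeg u
    hitting-bound (suc N) u = case u Fin.≟ v of λ where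
      (yes u≡v) → ≤-trans (≤-reflexive (𝔼min-here (suc N) u≡v)) (hitting-nonNeg u)
      (no u≢v)  → begin
        𝔼min (suc N) u                        ≡⟨ 𝔼min-suc N u≢v ⟩
        1ℚ + 𝔼 (randomNeighbour G u) (𝔼min N) ≤⟨ +-monoʳ-≤ 1ℚ (𝔼-mono (randomNeighbour G u) (hitting-bound N)) ⟩
        1ℚ + 𝔼 (randomNeighbour G u) h        ≡⟨ cong (λ y → 1ℚ + y) (𝔼-hitting h-solves u≢v) ⟩
        1ℚ + (h u - 1ℚ)                       ≡⟨ solve 1 (λ x → con 1ℚ :+ (x :- con 1ℚ) := x) refl (h u) ⟩
        h u                                   ∎

  -- Effective resistance under the push algorithm

  ∈-range⁻ : ∀ {u} ws → u ∈ range G ws → u ∈ₗ ws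
  ∈-range⁻ []       u∈ = contradiction u∈ ∉⊥
  ∈-range⁻ (w ∷ ws) u∈ = case x∈p∪q⁻ ⁅ w ⁆ (range G ws) u∈ of λ where
    (inj₁ u∈w)  → here (x∈⁅y⁆⇒x≡y w u∈w)
    (inj₂ u∈ws) → there (∈-range⁻ ws u∈ws)

  module Broadcast (s v : Fin n) (s≢v : s ≢ v) {ψ : Fin n → ℚ} (ψ-solves : Solves (_≡ s) (point G v) ψ) where
    open Hitting (push G) (v ∈?_)

    -- Adding `s` keeps the boundary non-empty for every `I`, as the recursions below range over all
    -- subsets and not only over those that contain `s`.
    Grounded : Subset n → Fin n → Set
    Grounded I u = u ∈ I ⊎ u ≡ s

    grounded? : ∀ I u → Dec (Grounded I u)
    grounded? I u = u ∈? I ⊎-dec u Fin.≟ s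

    -- Only the equations of `φ-solves` are used below; the constructed solution is kept from
    -- unfolding.
    abstract
      φ : Subset n → Fin n → ℚ
      φ I = proj₁ (solvable (grounded? I) (inj₂ refl) (point G v))

      φ-solves : ∀ I → Solves (Grounded I) (point G v) (φ I)
      φ-solves I = proj₂ (solvable (grounded? I) (inj₂ refl) (point G v))

    φ-nonNeg : ∀ I u → 0ℚ ≤ φ I u
    φ-nonNeg I = solution-nonNeg G (grounded? I) (inj₂ refl) (φ-solves I) (0≤point G v)

    ψ-nonNeg : ∀ u → 0ℚ ≤ ψ u
    ψ-nonNeg = solution-nonNeg G (Fin._≟ s) refl ψ-solves (0≤point G v)

    resistance : Subset n → ℚ
    resistance I = φ I v

    -- Rayleigh monotonicity: grounding more vertices than `s` can only lower the potential at `v`.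
    -- This bounds the resistance left when a run is cut off.
    resistance≤ψ[v] : ∀ I → resistance I ≤ ψ v
    resistance≤ψ[v] I = ≤-by-difference _ (x≤y⇒0≤y-x (comparison G (grounded? I) (inj₂ refl) (φ I) ψ {c = 0ℚ}
        (λ u gr → ≤-by-difference (ψ u) (ψ-nonNeg u) (trans (cong (λ y → 0ℚ - (y - ψ u)) (proj₁ (φ-solves I) u gr)) (solve 1 (λ x → con 0ℚ :- (con 0ℚ :- x) := x) refl (ψ u))))
        (λ u ¬gr → trans (proj₂ (φ-solves I) u ¬gr) (sym (proj₂ ψ-solves u (¬gr ∘ inj₂)))) v))
      (solve 2 (λ x y → y :- x := con 0ℚ :- (x :- y)) refl (resistance I) (ψ v))

    -- For the set `⁅ s ⁆` only `s` is grounded, so both functions solve the same problem.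
    ψ[v]≤resistance : ψ v ≤ resistance ⁅ s ⁆
    ψ[v]≤resistance = ≤-by-difference _ (x≤y⇒0≤y-x (comparison G (Fin._≟ s) refl ψ (φ ⁅ s ⁆) {c = 0ℚ}
        (λ u u≡s → ≤-reflexive (cong₂ _-_ (proj₁ ψ-solves u u≡s) (proj₁ (φ-solves ⁅ s ⁆) u (inj₂ u≡s))))
        (λ u u≢s → trans (proj₂ ψ-solves u u≢s) (sym (proj₂ (φ-solves ⁅ s ⁆) u (u≢s ∘ [ x∈⁅y⁆⇒x≡y s , id ]′)))) v))
      (solve 2 (λ x y → y :- x := con 0ℚ :- (x :- y)) refl (ψ v) (resistance ⁅ s ⁆))

    -- The source at `v` cancels in φ I - φ J, so this difference is controlled by its values on the
    -- vertices grounded for `J`: 0 on those already grounded and `φ I w` at a called `w`, all at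
    -- most the sum over `ws`.
    resistance-drop : ∀ I ws → resistance I - sumᴸ (φ I) ws ≤ resistance (I ∪ range G ws)
    resistance-drop I ws = ≤-by-difference _ (x≤y⇒0≤y-x (comparison G (grounded? J) (inj₂ refl) (φ I) (φ J) bound
          (λ u ¬gr → trans (proj₂ (φ-solves I) u (¬gr ∘ [ inj₁ ∘ x∈p∪q⁺ ∘ inj₁ , inj₂ ]′)) (sym (proj₂ (φ-solves J) u ¬gr))) v))
        (solve 3 (λ x c y → y :- (x :- c) := c :- (x :- y)) refl (resistance I) (sumᴸ (φ I) ws) (resistance J))
      where
      J = I ∪ range G ws
      grounded : ∀ {u} → Grounded I u → φ I u ≤ sumᴸ (φ I) ws
      grounded gr = ≤-trans (≤-reflexive (proj₁ (φ-solves I) _ gr)) (sumᴸ-nonNeg (φ-nonNeg I) ws)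
      informed : ∀ u → Grounded J u → φ I u ≤ sumᴸ (φ I) ws
      informed u (inj₂ u≡s) = grounded (inj₂ u≡s)
      informed u (inj₁ u∈J) = case x∈p∪q⁻ I (range G ws) u∈J of λ where
        (inj₁ u∈I)  → grounded (inj₁ u∈I)
        (inj₂ u∈ws) → sumᴸ-mem (φ-nonNeg I) (∈-range⁻ ws u∈ws)
      bound : ∀ u → Grounded J u → φ I u - φ J u ≤ sumᴸ (φ I) ws
      bound u gr = subst (_≤ sumᴸ (φ I) ws) (trans (solve 1 (λ x → x := x :- con 0ℚ) refl (φ I u)) (cong (λ y → φ I u - y) (sym (proj₁ (φ-solves J) u gr)))) (informed u gr)

    -- Grounded vertices have the least potential, so current only flows into them.
    Lφ≤0 : ∀ I u → Grounded I u → L (φ I) u ≤ 0ℚ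
    Lφ≤0 I u gr = ≤-by-difference _ (0≤sum {f = λ w → A u w * φ I w} (λ w → 0≤* (0≤𝟙 (does (adj? u w))) (φ-nonNeg I w)))
      (trans (cong (λ y → 0ℚ - y) (trans (L-expand (φ I) u) (cong (λ y → deg u * y - sum (λ w → A u w * φ I w)) (proj₁ (φ-solves I) u gr))))
        (solve 2 (λ d x → con 0ℚ :- (d :* con 0ℚ :- x) := x) refl (deg u) (sum (λ w → A u w * φ I w))))

    -- For informed `x` the left side is the current -L φ into `x` divided by the degree. Elsewhere
    -- the left side vanishes, and the right side is 0 except possibly at an uninformed `s`, into
    -- which current also flows. The `point` term makes the right sides add up to `δ⁻¹`.
    flow : ∀ I → ¬ v ∈ I → ∀ x → 𝟙 (does (x ∈? I)) * 𝔼 (randomNeighbour G x) (φ I) ≤ δ⁻¹ * (point G v x - L (φ I) x)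
    flow I v∉I x = case x ∈? I of λ where
        (yes x∈I) → ≤-by-difference _ (0≤* (x≤y⇒0≤y-x (deg⁻¹≤δ⁻¹ x)) (x≤y⇒0≤y-x (Lφ≤0 I x (inj₁ x∈I)))) (trans
          (cong₂ _-_ (cong (λ p → δ⁻¹ * (p - L (φ I) x)) (𝟙-no (x Fin.≟ v) λ { refl → v∉I x∈I }))
            (cong₂ _*_ (𝟙-yes (x ∈? I) x∈I) (trans (𝔼-neighbour x (φ I)) (cong (_- deg⁻¹ x * L (φ I) x) (proj₁ (φ-solves I) x (inj₁ x∈I))))))
          (solve 3 (λ i d l → i :* (con 0ℚ :- l) :- con 1ℚ :* (con 0ℚ :- d :* l) := (i :- d) :* (con 0ℚ :- l)) refl δ⁻¹ (deg⁻¹ x) (L (φ I) x)))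
        (no x∉I) → subst (_≤ δ⁻¹ * (point G v x - L (φ I) x))
          (sym (trans (cong (_* 𝔼 (randomNeighbour G x) (φ I)) (𝟙-no (x ∈? I) x∉I)) (*-zeroˡ (𝔼 (randomNeighbour G x) (φ I)))))
          (0≤* (<⇒≤ 0<δ⁻¹) (outside x∉I))
      where
      outside : ¬ x ∈ I → 0ℚ ≤ point G v x - L (φ I) x
      outside x∉I = case x Fin.≟ s of λ where
        (yes refl) → subst (λ p → 0ℚ ≤ p - L (φ I) x) (sym (𝟙-no (x Fin.≟ v) s≢v)) (x≤y⇒0≤y-x (Lφ≤0 I x (inj₂ refl)))
        (no x≢s)   → ≤-reflexive (sym (trans (cong (λ y → point G v x - y) (proj₂ (φ-solves I) x [ x∉I , x≢s ]′)) (+-inverseʳ (point G v x))))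

    drift : ∀ I → ¬ v ∈ I → resistance I ≤ δ⁻¹ + 𝔼 (push G I) resistance
    drift I v∉I = ≤-trans (≤-reflexive (solve 2 (λ d r → r := d :+ (r :- d)) refl δ⁻¹ (resistance I))) (+-monoʳ-≤ δ⁻¹ (begin
        resistance I - δ⁻¹
          ≤⟨ +-monoʳ-≤ (resistance I) (neg-antimono-≤ total) ⟩
        resistance I - sum (λ x → 𝟙 (does (x ∈? I)) * 𝔼 (randomNeighbour G x) (φ I))
          ≡⟨ cong (λ y → resistance I - y) (trans (sumᴸ-filter (_∈? I) _ (allFin n)) (sumᴸ-allFin (λ x → 𝟙 (does (x ∈? I)) * 𝔼 (randomNeighbour G x) (φ I)))) ⟨
        resistance I - sumᴸ (λ x → 𝔼 (randomNeighbour G x) (φ I)) informed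
          ≡⟨ cong₂ _-_ (𝔼-const calls (resistance I)) (𝔼-independently (randomNeighbour G) (φ I) informed) ⟨
        𝔼 calls (λ _ → resistance I) - 𝔼 calls (sumᴸ (φ I))
          ≡⟨ 𝔼-minus calls (λ _ → resistance I) (sumᴸ (φ I)) ⟨
        𝔼 calls (λ ws → resistance I - sumᴸ (φ I) ws)
          ≤⟨ 𝔼-mono calls (resistance-drop I) ⟩
        𝔼 calls (λ ws → resistance (I ∪ range G ws))
          ≡⟨ 𝔼->>= calls (λ ws → pure (I ∪ range G ws)) resistance ⟨
        𝔼 (push G I) resistance ∎))
      where
      open ≤-Reasoning
      informed = filter (_∈? I) (allFin n)
      calls = independently (randomNeighbour G) informed
      -- The values of `L (φ I)` sum to 0, so the current into the grounded set is the unit injected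
      -- at `v`.
      total : sum (λ x → 𝟙 (does (x ∈? I)) * 𝔼 (randomNeighbour G x) (φ I)) ≤ δ⁻¹
      total = begin
        sum (λ x → 𝟙 (does (x ∈? I)) * 𝔼 (randomNeighbour G x) (φ I)) ≤⟨ sum-mono (flow I v∉I) ⟩
        sum (λ x → δ⁻¹ * (point G v x - L (φ I) x))                  ≡⟨ *-distribˡ-sum δ⁻¹ (λ x → point G v x - L (φ I) x) ⟨
        δ⁻¹ * sum (λ x → point G v x - L (φ I) x)                    ≡⟨ cong (δ⁻¹ *_) (trans (sum-minus (point G v) (L (φ I))) (cong₂ _-_ (sum-𝟙≡ v) (sum-L (φ I)))) ⟩
        δ⁻¹ * (1ℚ - 0ℚ)                                              ≡⟨ solve 1 (λ d → d :* (con 1ℚ :- con 0ℚ) := d) refl δ⁻¹ ⟩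
        δ⁻¹                                                          ∎

    -- The drift inequality unrolled over N rounds: each round before `v` is informed costs at most
    -- `δ⁻¹`, and a run cut off at N leaves a resistance of at most `ψ v`.
    resistance-bound : ∀ N I → resistance I ≤ δ⁻¹ * 𝔼min N I + ψ v * survive N I
    resistance-bound zero    I = ≤-trans (resistance≤ψ[v] I) (≤-reflexive (solve 2 (λ d k → k := d :* con 0ℚ :+ k :* con 1ℚ) refl δ⁻¹ (ψ v)))
    resistance-bound (suc N) I = case v ∈? I of λ where
        (yes v∈I) → ≤-reflexive (trans (proj₁ (φ-solves I) v (inj₁ v∈I)) (sym (trans (cong₂ (λ y z → δ⁻¹ * y + ψ v * z) (𝔼min-here (suc N) v∈I) (survive-here N v∈I))
              (solve 2 (λ d k → d :* con 0ℚ :+ k :* con 0ℚ := con 0ℚ) refl δ⁻¹ (ψ v)))))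
        (no v∉I) → begin
          resistance I
            ≤⟨ drift I v∉I ⟩
          δ⁻¹ + 𝔼 (push G I) resistance
            ≤⟨ +-monoʳ-≤ δ⁻¹ (𝔼-mono (push G I) (resistance-bound N)) ⟩
          δ⁻¹ + 𝔼 (push G I) (λ J → δ⁻¹ * 𝔼min N J + ψ v * survive N J)
            ≡⟨ cong (λ y → δ⁻¹ + y) (trans (𝔼-+ (push G I) (λ J → δ⁻¹ * 𝔼min N J) (λ J → ψ v * survive N J)) (cong₂ _+_ (𝔼-* (push G I) δ⁻¹ (𝔼min N)) (𝔼-* (push G I) (ψ v) (survive N)))) ⟩
          δ⁻¹ + (δ⁻¹ * 𝔼 (push G I) (𝔼min N) + ψ v * 𝔼 (push G I) (survive N))
            ≡⟨ solve 3 (λ d e k → d :+ (d :* e :+ k) := d :* (con 1ℚ :+ e) :+ k) refl δ⁻¹ (𝔼 (push G I) (𝔼min N)) (ψ v * 𝔼 (push G I) (survive N)) ⟩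
          δ⁻¹ * (1ℚ + 𝔼 (push G I) (𝔼min N)) + ψ v * 𝔼 (push G I) (survive N)
            ≡⟨ cong₂ (λ y z → δ⁻¹ * y + ψ v * z) (𝔼min-suc N v∉I) (survive-suc N v∉I) ⟨
          δ⁻¹ * 𝔼min (suc N) I + ψ v * survive (suc N) I ∎
      where open ≤-Reasoning

    -- By Markov's inequality the survival term is at most half of the first
    -- one as soon as N ≥ 2 δ ψ(v).
    2ψ≤3δ⁻¹𝔼min : ∃[ N ] ψ v + ψ v ≤ (1ℚ + 1ℚ + 1ℚ) * δ⁻¹ * 𝔼min N ⁅ s ⁆
    2ψ≤3δ⁻¹𝔼min =
      let N , large = archimedean ((1ℚ + 1ℚ) * ι δ * ψ v)
          e = 𝔼min N ⁅ s ⁆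
          p = survive N ⁅ s ⁆
          bound : ψ v ≤ δ⁻¹ * e + ψ v * p
          bound = ≤-trans ψ[v]≤resistance (resistance-bound N ⁅ s ⁆)
          tail : (1ℚ + 1ℚ) * ι δ * ψ v * p ≤ e
          tail = ≤-trans (*-monoʳ (0≤survive N ⁅ s ⁆) large) (markov N ⁅ s ⁆)
      -- Twice `bound` gives 2ψ ≤ 2δ⁻¹e + 2ψp, and δ⁻¹ times `tail` gives 2ψp ≤ δ⁻¹e; together they
      -- produce the factor 3.
      in N , ≤-by-difference (((1ℚ + 1ℚ) * (δ⁻¹ * e + ψ v * p - ψ v)) + δ⁻¹ * (e - (1ℚ + 1ℚ) * ι δ * ψ v * p))
           (0≤+ (0≤* (nonNegative⁻¹ (1ℚ + 1ℚ)) (x≤y⇒0≤y-x bound)) (0≤* (<⇒≤ 0<δ⁻¹) (x≤y⇒0≤y-x tail)))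
           (begin
             (1ℚ + 1ℚ + 1ℚ) * δ⁻¹ * e - (ψ v + ψ v)
               ≡⟨ solve 4 (λ e k p i → (con 1ℚ :+ con 1ℚ :+ con 1ℚ) :* i :* e :- (k :+ k) := (con 1ℚ :+ con 1ℚ) :* (i :* e :+ k :* p :- k) :+ i :* e :- (con 1ℚ :+ con 1ℚ) :* con 1ℚ :* (k :* p)) refl e (ψ v) p δ⁻¹ ⟩
             (1ℚ + 1ℚ) * (δ⁻¹ * e + ψ v * p - ψ v) + δ⁻¹ * e - (1ℚ + 1ℚ) * 1ℚ * (ψ v * p)
               ≡⟨ cong (λ y → (1ℚ + 1ℚ) * (δ⁻¹ * e + ψ v * p - ψ v) + δ⁻¹ * e - (1ℚ + 1ℚ) * y * (ψ v * p)) δ⁻¹*δ ⟨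
             (1ℚ + 1ℚ) * (δ⁻¹ * e + ψ v * p - ψ v) + δ⁻¹ * e - (1ℚ + 1ℚ) * (δ⁻¹ * ι δ) * (ψ v * p)
               ≡⟨ solve 6 (λ x e k p i d → x :+ i :* e :- (con 1ℚ :+ con 1ℚ) :* (i :* d) :* (k :* p) := x :+ i :* (e :- (con 1ℚ :+ con 1ℚ) :* d :* k :* p)) refl ((1ℚ + 1ℚ) * (δ⁻¹ * e + ψ v * p - ψ v)) e (ψ v) p δ⁻¹ (ι δ) ⟩
             (1ℚ + 1ℚ) * (δ⁻¹ * e + ψ v * p - ψ v) + δ⁻¹ * (e - (1ℚ + 1ℚ) * ι δ * ψ v * p) ∎)
      where open ≡-Reasoning

-- The cover time in terms of hitting times

2ℚ : ℚ
2ℚ = 1ℚ + 1ℚ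

0≤2 : 0ℚ ≤ 2ℚ
0≤2 = nonNegative⁻¹ 2ℚ

½^ : ℕ → ℚ
½^ zero    = 1ℚ
½^ (suc j) = ½ * ½^ j

0≤½^ : ∀ j → 0ℚ ≤ ½^ j
0≤½^ zero    = nonNegative⁻¹ 1ℚ
0≤½^ (suc j) = 0≤* (nonNegative⁻¹ ½) (0≤½^ j)

½^*2^ : ∀ j → ½^ j * ι (2 ℕ.^ j) ≡ 1ℚ
½^*2^ zero    = refl
½^*2^ (suc j) = begin
  ½ * ½^ j * ι (2 ℕ.* 2 ℕ.^ j)   ≡⟨ cong (λ y → ½ * ½^ j * y) (ι-* 2 (2 ℕ.^ j)) ⟩
  ½ * ½^ j * (ι 2 * ι (2 ℕ.^ j)) ≡⟨ solve 2 (λ b t → con ½ :* b :* (con (ι 2) :* t) := b :* t) refl (½^ j) (ι (2 ℕ.^ j)) ⟩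
  ½^ j * ι (2 ℕ.^ j)             ≡⟨ ½^*2^ j ⟩
  1ℚ                             ∎
  where open ≡-Reasoning

≢⊤⇒∃∉ : ∀ {n} {I : Subset n} → I ≢ ⊤ → ∃[ v ] ¬ v ∈ I
≢⊤⇒∃∉ {n} {I} I≢⊤ = Fin.¬∀⟶∃¬ n (_∈ I) (_∈? I) λ all → I≢⊤ (⊆-antisym ⊆⊤ λ {x} _ → all x)

missing : ∀ {n} → Subset n → Fin n → ℚ
missing I v = 𝟙 (does (¬? (v ∈? I)))

missing-∈ : ∀ {n} {I : Subset n} {v} → v ∈ I → missing I v ≡ 0ℚ
missing-∈ {I = I} {v} v∈I = 𝟙-no (¬? (v ∈? I)) (λ v∉I → v∉I v∈I)

missing-∉ : ∀ {n} {I : Subset n} {v} → ¬ v ∈ I → missing I v ≡ 1ℚ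
missing-∉ {I = I} {v} v∉I = 𝟙-yes (¬? (v ∈? I)) v∉I

0≤missing : ∀ {n} (I : Subset n) v → 0ℚ ≤ missing I v
0≤missing I v = 0≤𝟙 (does (¬? (v ∈? I)))

missing-∪ : ∀ {n} (I J : Subset n) v → missing (I ∪ J) v ≤ missing I v
missing-∪ I J v = case v ∈? (I ∪ J) of λ where
  (yes v∈) → ≤-trans (≤-reflexive (missing-∈ v∈)) (0≤missing I v)
  (no v∉)  → ≤-reflexive (trans (missing-∉ v∉) (sym (missing-∉ (v∉ ∘ x∈p∪q⁺ ∘ inj₁))))

missing≤1 : ∀ {n} (I : Subset n) v → missing I v ≤ 1ℚ
missing≤1 I v = case v ∈? I of λ where
  (yes v∈) → ≤-trans (≤-reflexive (missing-∈ v∈)) (nonNegative⁻¹ 1ℚ)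
  (no v∉)  → ≤-reflexive (missing-∉ v∉)

module _ {n : ℕ} .{{_ : NonTrivial n}} (G : Graph n) where
  open Graph G
  open Potential G

  -- `visited` recomputes the range of each prefix; this version accumulates the visited set from an
  -- arbitrary `I`, so that it unfolds along with the walk.
  visitedFrom : Subset n → List (Fin n) → List (Subset n)
  visitedFrom I []      = []
  visitedFrom I (x ∷ ω) = I ∪ ⁅ x ⁆ ∷ visitedFrom (I ∪ ⁅ x ⁆) ω

  visitedFrom≡ : ∀ I ω → map (λ ws → I ∪ range G ws) (drop 1 (inits ω)) ≡ visitedFrom I ω
  visitedFrom≡ I []      = refl
  visitedFrom≡ I (x ∷ ω) = cong₂ _∷_ (cong (I ∪_) (∪-identityʳ ⁅ x ⁆)) (begin
    map (λ ws → I ∪ range G ws) (map (x ∷_) (drop 1 (inits ω))) ≡⟨ map-∘ (drop 1 (inits ω)) ⟨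
    map (λ ws → I ∪ (⁅ x ⁆ ∪ range G ws)) (drop 1 (inits ω))    ≡⟨ map-cong (λ ws → sym (∪-assoc I ⁅ x ⁆ (range G ws))) (drop 1 (inits ω)) ⟩
    map (λ ws → (I ∪ ⁅ x ⁆) ∪ range G ws) (drop 1 (inits ω))    ≡⟨ visitedFrom≡ (I ∪ ⁅ x ⁆) ω ⟩
    visitedFrom (I ∪ ⁅ x ⁆) ω                                   ∎)
    where open ≡-Reasoning

  visited≡ : ∀ ω → visited G ω ≡ visitedFrom ⊥ ω
  visited≡ ω = trans (map-cong (λ ws → sym (∪-identityˡ (range G ws))) (drop 1 (inits ω))) (visitedFrom≡ ⊥ ω)

  module Cover (H : Fin n → Fin n → ℚ) (H-solves : ∀ v → Solves (_≡ v) deg (H v)) {h : ℚ} (H≤h : ∀ v u → H v u ≤ h) where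

    remaining : Subset n → List (Fin n) → ℕ
    remaining I ω = firstTime (everyone? G) (visitedFrom I ω)

    𝔼remaining : ℕ → Subset n → Fin n → ℚ
    𝔼remaining N I = 𝔼time (randomNeighbour G) (remaining I) N

    weight : Subset n → Fin n → ℚ
    weight I x = sum (λ v → missing I v * (h + H v x))

    0≤H : ∀ v u → 0ℚ ≤ H v u
    0≤H v = hitting-nonNeg G (H-solves v)

    0≤h : 0ℚ ≤ h
    0≤h = let v = Fin.fromℕ< (ℕ.<-trans ℕ.z<s (ℕ.nonTrivial⇒n>1 n)) in ≤-trans (0≤H v v) (H≤h v v)

    0≤h+H : ∀ v u → 0ℚ ≤ h + H v u
    0≤h+H v u = 0≤+ 0≤h (0≤H v u)

    h+H≤2h : ∀ v u → h + H v u ≤ 2ℚ * h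
    h+H≤2h v u = ≤-trans (+-monoʳ-≤ h (H≤h v u)) (≤-reflexive (solve 1 (λ h → h :+ h := con 2ℚ :* h) refl h))

    0≤weight : ∀ I x → 0ℚ ≤ weight I x
    0≤weight I x = 0≤sum λ v → 0≤* (0≤missing I v) (0≤h+H v x)

    weight≤2hm : ∀ I x → weight I x ≤ 2ℚ * h * sum (missing I)
    weight≤2hm I x = ≤-trans (sum-mono λ v → ≤-trans (*-monoˡ (0≤missing I v) (h+H≤2h v x)) (≤-reflexive (*-comm (missing I v) (2ℚ * h))))
      (≤-reflexive (sym (*-distribˡ-sum (2ℚ * h) (missing I))))

    -- A missing `v` differs from `x`, as `x` has been visited, so its expected hitting time falls
    -- by 1 in a step. Newly visited vertices only remove non-negative terms.
    weight-drift : ∀ {I x} → x ∈ I → 𝔼 (randomNeighbour G x) (λ y → weight (I ∪ ⁅ y ⁆) y) ≤ weight I x - sum (missing I)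
    weight-drift {I} {x} x∈I = begin
      𝔼 R (λ y → weight (I ∪ ⁅ y ⁆) y)                       ≤⟨ 𝔼-mono R (λ y → sum-mono λ v → *-monoʳ (0≤h+H v y) (missing-∪ I ⁅ y ⁆ v)) ⟩
      𝔼 R (λ y → weight I y)                                 ≡⟨ 𝔼-sum R (λ v y → missing I v * (h + H v y)) ⟩
      sum (λ v → 𝔼 R (λ y → missing I v * (h + H v y)))      ≡⟨ sum-cong-≗ step ⟩
      sum (λ v → missing I v * (h + H v x) - missing I v)    ≡⟨ sum-minus (λ v → missing I v * (h + H v x)) (missing I) ⟩
      weight I x - sum (missing I)                           ∎
      where
      open ≤-Reasoning
      R = randomNeighbour G x
      step : ∀ v → 𝔼 R (λ y → missing I v * (h + H v y)) ≡ missing I v * (h + H v x) - missing I v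
      step v = trans (trans (𝔼-* R (missing I v) (λ y → h + H v y)) (cong (missing I v *_) (trans (𝔼-+ R (λ _ → h) (H v)) (cong (_+ 𝔼 R (H v)) (𝔼-const R h)))))
        (case v ∈? I of λ where
          (yes v∈I) → trans (cong (_* (h + 𝔼 R (H v))) (missing-∈ v∈I)) (trans (solve 2 (λ x y → con 0ℚ :* x := con 0ℚ :* y :- con 0ℚ) refl (h + 𝔼 R (H v)) (h + H v x))
                        (cong (λ m → m * (h + H v x) - m) (sym (missing-∈ v∈I))))
          (no v∉I)  → trans (cong (λ y → missing I v * (h + y)) (𝔼-hitting G (H-solves v) λ { refl → v∉I x∈I }))
                        (solve 3 (λ m h z → m :* (h :+ (z :- con 1ℚ)) := m :* (h :+ z) :- m) refl (missing I v) h (H v x)))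

    -- An affine function of the weight; from each j to the next the slope halves and the constant
    -- term grows by 2h, as for tangents of a logarithm. The current vertex `x` already counts as
    -- visited.
    bound : ℕ → Subset n → Fin n → ℚ
    bound j I x = 2ℚ * h * ι j + 2ℚ * ½^ j * weight (I ∪ ⁅ x ⁆) x

    0≤bound : ∀ j I x → 0ℚ ≤ bound j I x
    0≤bound j I x = 0≤+ (0≤* (0≤* 0≤2 0≤h) (0≤ι j)) (0≤* (0≤* 0≤2 (0≤½^ j)) (0≤weight (I ∪ ⁅ x ⁆) x))

    -- While m vertices are missing, the weight is at most 2hm and decreases
    -- by m per step in expectation.  So bound j pays for the step if
    -- 2m ≥ 2^j, and otherwise it is at least bound (j - 1).
    cover-bound : ∀ N j I x → 𝔼remaining N I x ≤ bound j I x
    cover-bound zero    j I x = 0≤bound j I x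
    cover-bound (suc N) j I x = case everyone? G (I ∪ ⁅ x ⁆) of λ where
        (yes all) → ≤-trans (≤-reflexive (𝔼time-zero (randomNeighbour G) (remaining I) (λ ω → firstTime-here (everyone? G) all (visitedFrom (I ∪ ⁅ x ⁆) ω)) N)) (0≤bound j I x)
        (no ¬all) → go ¬all j
      where
      open ≤-Reasoning
      I′ = I ∪ ⁅ x ⁆
      m = sum (missing I′)
      W = weight I′ x
      R = randomNeighbour G x

      x∈I′ : x ∈ I′
      x∈I′ = x∈p∪q⁺ (inj₂ (x∈⁅x⁆ x))

      1≤m : I′ ≢ ⊤ → 1ℚ ≤ m
      1≤m ¬all = let v , v∉I′ = ≢⊤⇒∃∉ ¬all in ≤-trans (≤-reflexive (sym (missing-∉ v∉I′))) (term≤sum (0≤missing I′) v)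

      step : I′ ≢ ⊤ → ∀ j → 𝔼remaining (suc N) I x ≤ 1ℚ + (2ℚ * h * ι j + 2ℚ * ½^ j * (W - m))
      step ¬all j = begin
        𝔼remaining (suc N) I x
          ≡⟨ 𝔼time-suc (randomNeighbour G) (remaining I) (remaining I′) (λ ω → firstTime-there (everyone? G) ¬all (visitedFrom I′ ω)) N ⟩
        1ℚ + 𝔼 R (𝔼remaining N I′)
          ≤⟨ +-monoʳ-≤ 1ℚ (𝔼-mono R (cover-bound N j I′)) ⟩
        1ℚ + 𝔼 R (bound j I′)
          ≡⟨ cong (λ y → 1ℚ + y) (trans (𝔼-+ R (λ _ → 2ℚ * h * ι j) (λ y → 2ℚ * ½^ j * weight (I′ ∪ ⁅ y ⁆) y))
               (cong₂ _+_ (𝔼-const R (2ℚ * h * ι j)) (𝔼-* R (2ℚ * ½^ j) (λ y → weight (I′ ∪ ⁅ y ⁆) y)))) ⟩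
        1ℚ + (2ℚ * h * ι j + 2ℚ * ½^ j * 𝔼 R (λ y → weight (I′ ∪ ⁅ y ⁆) y))
          ≤⟨ +-monoʳ-≤ 1ℚ (+-monoʳ-≤ (2ℚ * h * ι j) (*-monoˡ (0≤* 0≤2 (0≤½^ j)) (weight-drift x∈I′))) ⟩
        1ℚ + (2ℚ * h * ι j + 2ℚ * ½^ j * (W - m)) ∎

      pays : I′ ≢ ⊤ → ∀ j → 1ℚ ≤ 2ℚ * ½^ j * m → 𝔼remaining (suc N) I x ≤ bound j I x
      pays ¬all j 1≤ = ≤-trans (step ¬all j) (≤-by-difference _ (x≤y⇒0≤y-x 1≤)
        (solve 4 (λ a b w m → a :+ b :* w :- (con 1ℚ :+ (a :+ b :* (w :- m))) := b :* m :- con 1ℚ) refl (2ℚ * h * ι j) (2ℚ * ½^ j) W m))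

      go : I′ ≢ ⊤ → ∀ j → 𝔼remaining (suc N) I x ≤ bound j I x
      -- Some vertex is missing, so m ≥ 1 and the condition 2m ≥ 2^0 holds.
      go ¬all zero    = pays ¬all zero (≤-trans (1≤m ¬all) (≤-by-difference m (≤-trans (nonNegative⁻¹ 1ℚ) (1≤m ¬all)) (solve 1 (λ m → con 2ℚ :* con 1ℚ :* m :- m := m) refl m)))
      go ¬all (suc j) = case 1ℚ ≤? 2ℚ * ½^ (suc j) * m of λ where
        (yes 1≤) → pays ¬all (suc j) 1≤
        -- Passing from j to j + 1 adds 2h - ½^j W to the bound, which is non-negative because W ≤
        -- 2hm and here ½^j m < 1.
        (no 1≰)  → ≤-trans (go ¬all j) (≤-by-difference (½^ j * (2ℚ * h * m - W) + 2ℚ * h * (1ℚ - 2ℚ * ½^ (suc j) * m))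
          (0≤+ (0≤* (0≤½^ j) (x≤y⇒0≤y-x (weight≤2hm I′ x))) (0≤* (0≤* 0≤2 0≤h) (x≤y⇒0≤y-x (<⇒≤ (≰⇒> 1≰)))))
          (trans (cong (λ k → 2ℚ * h * k + 2ℚ * ½^ (suc j) * W - bound j I x) (ι-suc j))
            (solve 5 (λ h i b w m → con 2ℚ :* h :* (con 1ℚ :+ i) :+ con 2ℚ :* (con ½ :* b) :* w :- (con 2ℚ :* h :* i :+ con 2ℚ :* b :* w)
                := b :* (con 2ℚ :* h :* m :- w) :+ con 2ℚ :* h :* (con 1ℚ :- con 2ℚ :* (con ½ :* b) :* m)) refl h (ι j) (½^ j) W m)))

    -- At the start at most n vertices are missing, so the weight is at most 2h · 2^j; the slope 2 ·
    -- ½^j reduces it to 4h, whence the summand 2 beside j.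
    cover≤ : ∀ N j x → n ℕ.≤ 2 ℕ.^ j → 𝔼time (randomNeighbour G) (λ ω → firstTime (everyone? G) (visited G ω)) N x ≤ 2ℚ * h * (ι j + 2ℚ)
    cover≤ N j x n≤2^j = begin
      𝔼time (randomNeighbour G) (λ ω → firstTime (everyone? G) (visited G ω)) N x
        ≡⟨ 𝔼-cong (trajectory (randomNeighbour G) x N) (λ ω → cong (ι ∘ firstTime (everyone? G)) (visited≡ ω)) ⟩
      𝔼remaining N ⊥ x
        ≤⟨ cover-bound N j ⊥ x ⟩
      2ℚ * h * ι j + 2ℚ * ½^ j * weight (⊥ ∪ ⁅ x ⁆) x
        ≤⟨ +-monoʳ-≤ (2ℚ * h * ι j) (*-monoˡ (0≤* 0≤2 (0≤½^ j)) weight≤) ⟩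
      2ℚ * h * ι j + 2ℚ * ½^ j * (2ℚ * h * ι (2 ℕ.^ j))
        ≡⟨ solve 4 (λ h i b t → con 2ℚ :* h :* i :+ con 2ℚ :* b :* (con 2ℚ :* h :* t) := con 2ℚ :* h :* (i :+ con 2ℚ :* (b :* t))) refl h (ι j) (½^ j) (ι (2 ℕ.^ j)) ⟩
      2ℚ * h * (ι j + 2ℚ * (½^ j * ι (2 ℕ.^ j)))
        ≡⟨ cong (λ y → 2ℚ * h * (ι j + 2ℚ * y)) (½^*2^ j) ⟩
      2ℚ * h * (ι j + 2ℚ * 1ℚ)
        ≡⟨ cong (λ y → 2ℚ * h * (ι j + y)) (*-identityʳ 2ℚ) ⟩
      2ℚ * h * (ι j + 2ℚ) ∎
      where
      open ≤-Reasoning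
      I = ⊥ ∪ ⁅ x ⁆
      weight≤ : weight I x ≤ 2ℚ * h * ι (2 ℕ.^ j)
      weight≤ = ≤-trans (weight≤2hm I x) (*-monoˡ (0≤* 0≤2 0≤h) (begin
        sum (missing I)      ≤⟨ sum-mono (missing≤1 I) ⟩
        sum {n} (λ _ → 1ℚ)   ≡⟨ trans (sum-const n 1ℚ) (*-identityʳ (ι n)) ⟩
        ι n                  ≤⟨ ι-mono n≤2^j ⟩
        ι (2 ℕ.^ j)          ∎))

-- A rational below the logarithm

log-bracket : ∀ n .{{_ : NonTrivial n}} → ∃[ m ] 2 ^ m ℕ.< n × n ℕ.≤ 2 ^ suc m
log-bracket 2                       = 0 , s≤s (s≤s z≤n) , ℕ.≤-refl
log-bracket (suc k@(suc (suc _))) with log-bracket k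
... | m , 2^m<k , k≤2^1+m with suc k ℕ.≤? 2 ^ suc m
...   | yes le = m , ℕ.m<n⇒m<1+n 2^m<k , le
...   | no  gt = suc m , ℕ.≰⇒> gt , ℕ.≤-trans (s≤s k≤2^1+m) (ℕ.+-mono-≤ (ℕ.m^n>0 2 (suc m)) (ℕ.m≤m+n (2 ^ suc m) 0))

-- l = m for 2^m < n ≤ 2^(m+1), except that m = 0 for n = 2, where l = ½.
log₂-lower : ∀ n .{{_ : NonTrivial n}} → ∃[ j ] ∃[ l ] n ℕ.≤ 2 ^ j × lower (log₂ n) l × 0ℚ ≤ l × ι j + 2ℚ ≤ (+ 8 / 1) * l
log₂-lower n = case log-bracket n of λ where
  -- Here n = 2, and l = m = 0 could not dominate j + 2 = 3. The value ½ lies below log₂ 2 since 2 <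
  -- 2², and 8 · ½ = 4.
  (zero , 1<n , n≤2) → 1 , ½ , n≤2 , inj₂ (ℕ.≤-trans (s≤s (s≤s (s≤s z≤n))) (ℕ.^-monoˡ-≤ 2 1<n)) , nonNegative⁻¹ ½ , ≤-by-difference 1ℚ (nonNegative⁻¹ 1ℚ) refl
  (m@(suc m′) , 2^m<n , n≤2^1+m) → suc m , ι m , n≤2^1+m
    , subst (lower (log₂ n)) (sym (ι≡mkℚ m)) (inj₂ (ℕ.≤-trans 2^m<n (ℕ.≤-reflexive (sym (ℕ.*-identityʳ n)))))
    , 0≤ι m
    , ≤-by-difference ((+ 7 / 1) * ι m′ + (+ 4 / 1)) (0≤+ (0≤* (nonNegative⁻¹ (+ 7 / 1)) (0≤ι m′)) (nonNegative⁻¹ (+ 4 / 1)))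
      (trans (cong₂ (λ x y → (+ 8 / 1) * x - (y + 2ℚ)) (ι-suc m′) (trans (ι-suc m) (cong (λ y → 1ℚ + y) (ι-suc m′))))
        (solve 1 (λ x → con (+ 8 / 1) :* (con 1ℚ :+ x) :- (con 1ℚ :+ (con 1ℚ :+ x) :+ con 2ℚ) := con (+ 7 / 1) :* x :+ con (+ 4 / 1)) refl (ι m′)))

-- The cut of a product asks for rationals strictly below each factor; this supplies the positivity
-- needed to shrink the factors.
*-pos⁻ : ∀ {x y} → 0ℚ ≤ x → 0ℚ ≤ y → 0ℚ < x * y → 0ℚ < x × 0ℚ < y
*-pos⁻ {x} {y} 0≤x 0≤y 0<xy =
    ≰⇒> (λ x≤0 → <-irrefl (trans (sym (*-zeroˡ y)) (cong (_* y) (≤-antisym 0≤x x≤0))) 0<xy)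
  , ≰⇒> (λ y≤0 → <-irrefl (trans (sym (*-zeroʳ x)) (cong (λ z → x * z) (≤-antisym 0≤y y≤0))) 0<xy)

firstTime-mono : ∀ {S : Set} {P Q : S → Set} (P? : Decidable P) (Q? : Decidable Q) → (∀ {x} → Q x → P x) →
                 ∀ ω → firstTime P? ω ℕ.≤ firstTime Q? ω
firstTime-mono P? Q? Q⊆P []      = z≤n
firstTime-mono P? Q? Q⊆P (x ∷ ω) with P? x | Q? x
... | yes _  | _     = z≤n
... | no ¬Px | yes Qx = contradiction (Q⊆P Qx) ¬Px
... | no _   | no _  = s≤s (firstTime-mono P? Q? Q⊆P ω)

-- The three bounds as statements about cuts

module _ {n : ℕ} .{{_ : NonTrivial n}} (G : Graph n) where
  open Graph G
  open Potential G

  hitTime : Fin n → Fin n → ℕ → ℚ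
  hitTime u v N = 𝔼time (randomNeighbour G) (firstTime (Fin._≟ v)) N u

  coverTime : Fin n → ℕ → ℚ
  coverTime s N = 𝔼time (randomNeighbour G) (λ ω → firstTime (everyone? G) (visited G ω)) N s

  informTime : Fin n → Fin n → ℕ → ℚ
  informTime s v N = 𝔼time (push G) (firstTime (v ∈?_)) N ⁅ s ⁆

  broadcastTime : Fin n → ℕ → ℚ
  broadcastTime s N = 𝔼time (push G) (firstTime (everyone? G)) N ⁅ s ⁆

  informTime≤broadcastTime : ∀ s v N → informTime s v N ≤ broadcastTime s N
  informTime≤broadcastTime s v N = 𝔼-mono (trajectory (push G) ⁅ s ⁆ N) λ ω →
    ι-mono (firstTime-mono (v ∈?_) (everyone? G) (λ { refl → ∈⊤ }) ω)

  0≤∣E∣/δ : 0ℚ ≤ ∣E∣/δ G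
  0≤∣E∣/δ = nonNegative⁻¹ (∣E∣/δ G) {{normalize-nonNeg ∣E∣ δ {{δ-nonZero G}}}}

  abstract
    -- The target comes first: `hitting v u` stands for H(u,v).
    hitting : Fin n → Fin n → ℚ
    hitting v = proj₁ (solvable (Fin._≟ v) refl deg)

    hitting-solves : ∀ v → Solves (_≡ v) deg (hitting v)
    hitting-solves v = proj₂ (solvable (Fin._≟ v) refl deg)

  -- The potentials give 2|E| ψ(v) for the left side, and 2ψ(v) is at most 3/δ times a truncated
  -- broadcast time. The factor 3 leaves room below 4 for the strict inequalities of cuts.
  commute-bound : ∀ s v → s ≢ v → ∃[ N ] hitting v s + hitting s v ≤ (+ 3 / 1) * ∣E∣/δ G * informTime s v N
  commute-bound s v s≢v =
    let ψ , ψ-solves = solvable (Fin._≟ s) refl (point G v)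
        N , 2ψ≤ = Broadcast.2ψ≤3δ⁻¹𝔼min G s v s≢v ψ-solves
    in N , (begin
      hitting v s + hitting s v                              ≡⟨ commute≡resistance G (hitting-solves v) (hitting-solves s) ψ-solves ⟩
      (ι ∣E∣ + ι ∣E∣) * ψ v                      ≡⟨ solve 2 (λ x y → (x :+ x) :* y := x :* (y :+ y)) refl (ι ∣E∣) (ψ v) ⟩
      ι ∣E∣ * (ψ v + ψ v)                        ≤⟨ *-monoˡ (0≤ι ∣E∣) 2ψ≤ ⟩
      ι ∣E∣ * ((1ℚ + 1ℚ + 1ℚ) * δ⁻¹ G * informTime s v N) ≡⟨ solve 3 (λ x d e → x :* ((con 1ℚ :+ con 1ℚ :+ con 1ℚ) :* d :* e) := con (+ 3 / 1) :* (x :* d) :* e) refl (ι ∣E∣) (δ⁻¹ G) (informTime s v N) ⟩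
      (+ 3 / 1) * (ι ∣E∣ * δ⁻¹ G) * informTime s v N ≡⟨ cong (λ x → (+ 3 / 1) * x * informTime s v N) (m/k≡m*1/k ∣E∣ δ {{δ-nonZero G}}) ⟨
      (+ 3 / 1) * ∣E∣/δ G * informTime s v N     ∎)
    where open ≤-Reasoning

  -- The largest hitting time h is at most a commute time, hence at most 3|E|/δ times a truncated
  -- broadcast time. The factor 48 is 2 · 8 · 3, from 2h in `cover≤`, from j + 2 ≤ 8l and from this
  -- estimate.
  cover-bound-log : ∃[ l ] lower (log₂ n) l × 0ℚ ≤ l × ∃[ s ] ∃[ N ] (∀ t N₀ → coverTime t N₀ ≤ (+ 48 / 1) * ∣E∣/δ G * l * broadcastTime s N)
  cover-bound-log =
    let instance nz = ℕ.nonTrivial⇒nonZero n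
        -- Two nested maxima: the inner one finds the worst start for each target, the outer one the
        -- worst target.
        v , v-max = argmax λ v → hitting v (proj₁ (argmax (hitting v)))
        s , s-max = argmax (hitting v)
        h = hitting v s
        H≤h : ∀ v u → hitting v u ≤ h
        H≤h = λ w u → ≤-trans (proj₂ (argmax (hitting w)) u) (v-max w)
        N , h≤ = h-bound s v
        j , l , n≤2^j , l<log , 0≤l , j+2≤8l = log₂-lower n
        e = broadcastTime s N
        x = ∣E∣/δ G
        0≤h = hitting-nonNeg G (hitting-solves v) s
    in l , l<log , 0≤l , s , N , λ t N₀ → begin
      coverTime t N₀                    ≤⟨ Cover.cover≤ G hitting hitting-solves H≤h N₀ j t n≤2^j ⟩
      2ℚ * h * (ι j + 2ℚ)               ≤⟨ *-monoˡ (0≤* 0≤2 0≤h) j+2≤8l ⟩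
      2ℚ * h * ((+ 8 / 1) * l)          ≡⟨ solve 2 (λ h l → con 2ℚ :* h :* (con (+ 8 / 1) :* l) := con (+ 16 / 1) :* l :* h) refl h l ⟩
      (+ 16 / 1) * l * h                ≤⟨ *-monoˡ (0≤* (nonNegative⁻¹ (+ 16 / 1)) 0≤l) h≤ ⟩
      (+ 16 / 1) * l * ((+ 3 / 1) * x * e) ≡⟨ solve 3 (λ l x e → con (+ 16 / 1) :* l :* (con (+ 3 / 1) :* x :* e) := con (+ 48 / 1) :* x :* l :* e) refl l x e ⟩
      (+ 48 / 1) * x * l * e            ∎
    where
    open ≤-Reasoning
    h-bound : ∀ s v → ∃[ N ] hitting v s ≤ (+ 3 / 1) * ∣E∣/δ G * broadcastTime s N
    h-bound s v = case s Fin.≟ v of λ where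
      (yes s≡v) → 0 , ≤-reflexive (trans (proj₁ (hitting-solves v) s s≡v) (sym (*-zeroʳ ((+ 3 / 1) * ∣E∣/δ G))))
      (no s≢v)  → let N , bound = commute-bound s v s≢v in N , (begin
        hitting v s                                    ≡⟨ +-identityʳ (hitting v s) ⟨
        hitting v s + 0ℚ                               ≤⟨ +-monoʳ-≤ (hitting v s) (hitting-nonNeg G (hitting-solves s) v) ⟩
        hitting v s + hitting s v                            ≤⟨ bound ⟩
        (+ 3 / 1) * ∣E∣/δ G * informTime s v N   ≤⟨ *-monoˡ (0≤* (nonNegative⁻¹ (+ 3 / 1)) 0≤∣E∣/δ) (informTime≤broadcastTime s v N) ⟩
        (+ 3 / 1) * ∣E∣/δ G * broadcastTime s N  ∎)

  C≼ : ∀ s v → s ≢ v → C G s v ≼ ⟦ (+ 4 / 1) * ∣E∣/δ G ⟧ ⊗ 𝔼RBAto G s v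
  C≼ s v s≢v q (a , b , (N₁ , a<) , (N₂ , b<) , q<a+b) = case q <? 0ℚ of λ where
      (yes q<0) → inj₁ q<0
      (no q≮0)  →
        let N , bound = commute-bound s v s≢v
            e = informTime s v N
            x = ∣E∣/δ G
            q<3xe = begin-strict
              q                                <⟨ q<a+b ⟩
              a + b                            <⟨ +-mono-< a< b< ⟩
              hitTime s v N₁ + hitTime v s N₂  ≤⟨ +-mono-≤ (hitting-bound G (hitting-solves v) N₁ s) (hitting-bound G (hitting-solves s) N₂ v) ⟩
              hitting v s + hitting s v                    ≤⟨ bound ⟩
              (+ 3 / 1) * x * e                ∎
            0≤e = 0≤𝔼time (push G) (firstTime (v ∈?_)) N ⁅ s ⁆
            0<3x , 0<e = *-pos⁻ (0≤* (nonNegative⁻¹ (+ 3 / 1)) 0≤∣E∣/δ) 0≤e (≤-<-trans (≮⇒≥ q≮0) q<3xe)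
            _ , 0<x = *-pos⁻ (nonNegative⁻¹ (+ 3 / 1)) 0≤∣E∣/δ 0<3x
        -- The slack is split between the factors: 3xe = (7/2 x)(6/7 e) with 7/2 < 4 and 6/7 < 1,
        -- and both gaps are strict as x and e are positive.
        in inj₂ ( (+ 7 / 2) * x , (+ 6 / 7) * e
          , (0≤* (nonNegative⁻¹ (+ 7 / 2)) 0≤∣E∣/δ , *-monoˡ-<-pos x {{positive 0<x}} {+ 7 / 2} {+ 4 / 1} (7/2<4 ))
          , (0≤* (nonNegative⁻¹ (+ 6 / 7)) 0≤e , N , <-by-difference ((+ 1 / 7) * e) (0<* (positive⁻¹ (+ 1 / 7)) 0<e) (solve 1 (λ e → e :- con (+ 6 / 7) :* e := con (+ 1 / 7) :* e) refl e))
          , <-≤-trans q<3xe (≤-reflexive (solve 2 (λ x e → con (+ 3 / 1) :* x :* e := con (+ 7 / 2) :* x :* (con (+ 6 / 7) :* e)) refl x e)))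
    where
    open ≤-Reasoning
    7/2<4 : + 7 / 2 < + 4 / 1
    7/2<4 = *<* (ℤ.+<+ (ℕ.n<1+n 7))

  128x<256x : 0ℚ < ∣E∣/δ G → (+ 128 / 1) * ∣E∣/δ G < (+ 256 / 1) * ∣E∣/δ G
  128x<256x 0<x = <-by-difference ((+ 128 / 1) * ∣E∣/δ G) (0<* (positive⁻¹ (+ 128 / 1)) 0<x)
    (solve 1 (λ x → con (+ 256 / 1) :* x :- con (+ 128 / 1) :* x := con (+ 128 / 1) :* x) refl (∣E∣/δ G))

  COV≼ : COV G ≼ ⟦ (+ 256 / 1) * ∣E∣/δ G ⟧ ⊗ log₂ n ⊗ 𝔼RBA G
  COV≼ q (t , N₀ , q<) = case q <? 0ℚ of λ where
      (yes q<0) → inj₁ q<0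
      (no q≮0)  →
        let l , l<log , 0≤l , s , N , bound = cover-bound-log
            e = broadcastTime s N
            x = ∣E∣/δ G
            q<48xle = <-≤-trans q< (bound t N₀)
            0≤e = 0≤𝔼time (push G) (firstTime (everyone? G)) N ⁅ s ⁆
            0≤48x = 0≤* (nonNegative⁻¹ (+ 48 / 1)) 0≤∣E∣/δ
            0<48xl , 0<e = *-pos⁻ (0≤* 0≤48x 0≤l) 0≤e (≤-<-trans (≮⇒≥ q≮0) q<48xle)
            0<48x , 0<l = *-pos⁻ 0≤48x 0≤l 0<48xl
            _ , 0<x = *-pos⁻ (nonNegative⁻¹ (+ 48 / 1)) 0≤∣E∣/δ 0<48x
        -- 48xle is split as (96xl)(½e); then 96xl < 128x · l and 128x < 256x provide for the inner
        -- product.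
        in inj₂ ( (+ 96 / 1) * x * l , ½ * e
          , (0≤* (0≤* (nonNegative⁻¹ (+ 96 / 1)) 0≤∣E∣/δ) 0≤l , inj₂ ( (+ 128 / 1) * x , l
              , (0≤* (nonNegative⁻¹ (+ 128 / 1)) 0≤∣E∣/δ , 128x<256x 0<x) , (0≤l , l<log)
              , <-by-difference ((+ 32 / 1) * (x * l)) (0<* (positive⁻¹ (+ 32 / 1)) (0<* 0<x 0<l))
                  (solve 2 (λ x l → con (+ 128 / 1) :* x :* l :- con (+ 96 / 1) :* x :* l := con (+ 32 / 1) :* (x :* l)) refl x l)))
          , (0≤* (nonNegative⁻¹ ½) 0≤e , s , N , <-by-difference (½ * e) (0<* (positive⁻¹ ½) 0<e) (solve 1 (λ e → e :- con ½ :* e := con ½ :* e) refl e))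
          , <-≤-trans q<48xle (≤-reflexive (solve 3 (λ x l e → con (+ 48 / 1) :* x :* l :* e := con (+ 96 / 1) :* x :* l :* (con ½ :* e)) refl x l e)))

  𝓡≼ : 𝓡 G ≼ ⟦ (+ 256 / 1) * ∣E∣/δ G ⟧ ⊗ log₂ n
  𝓡≼ q (inj₁ q<0) = inj₁ q<0
  𝓡≼ q (inj₂ (a , b , (t , N₀ , a<) , <b , qb<a)) = case q <? 0ℚ of λ where
      (yes q<0) → inj₁ q<0
      (no q≮0)  →
        let l , l<log , 0≤l , s , N , bound = cover-bound-log
            e = broadcastTime s N
            x = ∣E∣/δ G
            -- `b` lies above the maximum over all starts, in particular above a bound `r` on all
            -- truncations from `s`. Hence b > e ≥ 0, and `b` can be cancelled below.
            r , ≤r , r<b = <b s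
            0≤e = 0≤𝔼time (push G) (firstTime (everyone? G)) N ⁅ s ⁆
            e<b = ≤-<-trans (≤r N) r<b
            0≤48x = 0≤* (nonNegative⁻¹ (+ 48 / 1)) 0≤∣E∣/δ
            qb< = begin-strict
              q * b                     <⟨ qb<a ⟩
              a                         <⟨ a< ⟩
              coverTime t N₀            ≤⟨ bound t N₀ ⟩
              (+ 48 / 1) * x * l * e    ≤⟨ *-monoˡ (0≤* 0≤48x 0≤l) (<⇒≤ e<b) ⟩
              (+ 48 / 1) * x * l * b    ∎
            q<48xl = *-cancelʳ-<-nonNeg b {{nonNegative (≤-trans 0≤e (<⇒≤ e<b))}} qb<
            0<48x , 0<l = *-pos⁻ 0≤48x 0≤l (≤-<-trans (≮⇒≥ q≮0) q<48xl)
            _ , 0<x = *-pos⁻ (nonNegative⁻¹ (+ 48 / 1)) 0≤∣E∣/δ 0<48x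
        in inj₂ ( (+ 128 / 1) * x , l
          , (0≤* (nonNegative⁻¹ (+ 128 / 1)) 0≤∣E∣/δ , 128x<256x 0<x) , (0≤l , l<log)
          , <-≤-trans q<48xl (≤-by-difference ((+ 80 / 1) * (x * l)) (0≤* (nonNegative⁻¹ (+ 80 / 1)) (0≤* 0≤∣E∣/δ 0≤l))
              (solve 2 (λ x l → con (+ 128 / 1) :* x :* l :- con (+ 48 / 1) :* x :* l := con (+ 80 / 1) :* (x :* l)) refl x l)))
    where open ≤-Reasoning

theorem3p8 : (∀ (n : ℕ) .{{_ : NonTrivial n}} (G : Graph n) (s v : Fin n) → s ≢ v →
    C G s v ≼ ⟦ (+ 4 / 1) * ∣E∣/δ G ⟧ ⊗ 𝔼RBAto G s v)
    × (∃[ c ] (0ℚ < c) × (∀ (n : ℕ) .{{_ : NonTrivial n}} (G : Graph n) →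
    COV G ≼ ⟦ c * ∣E∣/δ G ⟧ ⊗ log₂ n ⊗ 𝔼RBA G))
    × (∃[ c ] (0ℚ < c) × (∀ (n : ℕ) .{{_ : NonTrivial n}} (G : Graph n) →
    𝓡 G ≼ ⟦ c * ∣E∣/δ G ⟧ ⊗ log₂ n))
theorem3p8 = (λ n G → C≼ G)
           , (+ 256 / 1 , positive⁻¹ (+ 256 / 1) , λ n G → COV≼ G)
           , (+ 256 / 1 , positive⁻¹ (+ 256 / 1) , λ n G → 𝓡≼ G)
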